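{- Let $n\geq 2$ and let $P\subseteq\mathbb{R}^n$ be an $n$-dimensional lattice simplex. Then $c(P)\geq 0$.
   Context: A lattice simplex in $\mathbb{R}^n$ of dimension $n$ is the convex hull of $n+1$ affinely independent points of $\mathbb{Z}^n$. For an $n$-dimensional lattice polytope $P$, $\mathcal{F}(P)_j$ denotes the set of $j$-dimensional faces of $P$ ($P$ itself being the only $n$-dimensional face), and $c(P)=\sum_{j=0}^n(-1)^{n-j}(j+1)\sum_{F\in\mathcal{F}(P)_j}\mathrm{Vol}_{\mathbb{Z}}(F)$, where $\mathrm{Vol}_{\mathbb{Z}}(F)$ is the volume on the affine span $\mathrm{aff}(F)$ normalized so that a fundamental parallelepiped of $\mathrm{aff}(F)\cap\mathbb{Z}^n$ has volume $\dim(F)!$. -}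

module Defs where

open import Data.Nat.Base as ℕ using (ℕ; zero; suc; _∸_; _!)
open import Data.Nat.Properties using (_≟_)
open import Data.Integer.Base as ℤ using (ℤ; +_; 0ℤ; -1ℤ)
open import Data.Rational.Base using (ℚ; 0ℚ; 1ℚ; _/_; _+_; _-_; _*_; _≤_; _<_)
open import Data.Rational.Properties using (+-0-commutativeMonoid)
open import Algebra.Properties.CommutativeMonoid.Sum +-0-commutativeMonoid public using (sum)
open import Data.Fin.Base using (Fin; toℕ)
open import Data.Fin.Subset using (Subset; inside; outside; ∣_∣; _∉_)
open import Data.Vec.Base as Vec using (Vec; lookup)
open import Data.List.Base as List using (List; []; length; filter; _++_)
open import Data.List.Membership.Propositional using (_∈_)
open import Data.List.Relation.Unary.All using (All)
open import Data.List.Relation.Unary.Unique.Propositional using (Unique)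
open import Data.Product.Base using (_×_; ∃; ∃-syntax)
open import Function.Bundles using (_⇔_)
open import Relation.Binary.PropositionalEquality.Core using (_≡_)

fromℤ : ℤ → ℚ
fromℤ z = z / 1

fromℕ : ℕ → ℚ
fromℕ m = fromℤ (+ m)

-- All data below are rational polyhedra, so rational points suffice: none of
-- the conditions used changes its truth value when ℚ is replaced by ℝ.
Point : ℕ → Set
Point n = Fin n → ℚ

LatticePoint : ℕ → Set
LatticePoint n = Fin n → ℤ

toPoint : ∀ {n} → LatticePoint n → Point n
toPoint x a = fromℤ (x a)

combination : ∀ {m n} → (Fin m → ℚ) → (Fin m → LatticePoint n) → Point n
combination μ v a = sum (λ i → μ i * fromℤ (v i a))

AffinelyIndependent : ∀ {m n} → (Fin m → LatticePoint n) → Set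
AffinelyIndependent {m} {n} v =
  (μ : Fin m → ℚ) → sum μ ≡ 0ℚ → (∀ a → combination μ v a ≡ 0ℚ) → ∀ i → μ i ≡ 0ℚ

record LatticeSimplex (n : ℕ) : Set where
  field
    vertex      : Fin (suc n) → LatticePoint n
    independent : AffinelyIndependent vertex

open LatticeSimplex public

-- The faces of a simplex are the convex hulls of the nonempty subsets F of its
-- vertex set; the one spanned by F has dimension ∣ F ∣ - 1.

subsets : ∀ n → List (Subset n)
subsets zero    = List.[ Vec.[] ]
subsets (suc n) = List.map (outside Vec.∷_) (subsets n) ++ List.map (inside Vec.∷_) (subsets n)

faces : ∀ n → ℕ → List (Subset (suc n))
faces n j = filter (λ F → ∣ F ∣ ≟ suc j) (subsets (suc n))

module _ {n : ℕ} (P : LatticeSimplex n) (F : Subset (suc n)) where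

  InAff : Point n → Set
  InAff x = ∃[ μ ] (∀ i → i ∉ F → μ i ≡ 0ℚ) × sum μ ≡ 1ℚ
                 × (∀ a → x a ≡ combination μ (vertex P) a)

  InFace : Point n → Set
  InFace x = ∃[ μ ] (∀ i → 0ℚ ≤ μ i) × (∀ i → i ∉ F → μ i ≡ 0ℚ) × sum μ ≡ 1ℚ
                  × (∀ a → x a ≡ combination μ (vertex P) a)

  -- An origin and a basis for the affine lattice aff(F) ∩ ℤⁿ.
  record LatticeFrame (j : ℕ) : Set where
    field
      origin : LatticePoint n
      basis  : Fin j → LatticePoint n

    point : (Fin j → ℚ) → Point n
    point s a = fromℤ (origin a) + combination s basis a

    field
      spans : (x : LatticePoint n) →
              InAff (toPoint x) ⇔
              (∃ λ (z : Fin j → ℤ) → ∀ a → toPoint x a ≡ point (λ i → fromℤ (z i)) a)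
      basis-independent : (z : Fin j → ℤ) →
              (∀ a → combination (λ i → fromℤ (z i)) basis a ≡ 0ℚ) →
              ∀ i → z i ≡ 0ℤ

    -- For k ≥ 1 and Π = { Σ tᵢ basisᵢ : 0 ≤ tᵢ < 1 } the fundamental
    -- parallelepiped, the sets origin + (z + Π)/k, z ∈ ℤʲ, tile aff(F).  In
    -- frame coordinates s the tile at z is given by zᵢ ≤ k sᵢ < zᵢ + 1.
    InTile : ℕ → Vec ℤ j → (Fin j → ℚ) → Set
    InTile k z s = ∀ i → fromℤ (lookup z i) ≤ fromℕ k * s i
                       × fromℕ k * s i < fromℤ (lookup z i) + 1ℚ

    TileInside : ℕ → Vec ℤ j → Set
    TileInside k z = ∀ s → InTile k z s → InFace (point s)

    TileMeets : ℕ → Vec ℤ j → Set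
    TileMeets k z = ∃ λ (s : Fin j → ℚ) → InTile k z s × InFace (point s)

    -- V is the Jordan content of the face on aff(F), with Π having content j !:
    -- a tile at scale k has content j ! / kʲ, and as k → ∞ the total content
    -- of disjoint tiles inside the face, and that of tiles covering it,
    -- come within any ε of V.
    HasContent : ℚ → Set
    HasContent V =
      (ε : ℚ) → 0ℚ < ε → ∃[ K ] ((k : ℕ) → K ℕ.≤ k →
        (∃[ zs ] Unique zs × All (TileInside k) zs
               × (V - ε) * fromℕ (k ℕ.^ j) ≤ fromℕ (j ! ℕ.* length zs))
        × (∃[ zs ] (∀ z → TileMeets k z → z ∈ zs)
               × fromℕ (j ! ℕ.* length zs) ≤ (V + ε) * fromℕ (k ℕ.^ j)))

  IsNormalizedVolume : ℕ → ℚ → Set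
  IsNormalizedVolume j V = ∃ λ (L : LatticeFrame j) → LatticeFrame.HasContent L V

-- vol F is Vol_ℤ of the face spanned by F (its value at the empty set is
-- unconstrained, and not used in c).
IsVolumeFunction : ∀ {n} → LatticeSimplex n → (Subset (suc n) → ℚ) → Set
IsVolumeFunction {n} P vol =
  ∀ j F → ∣ F ∣ ≡ suc j → IsNormalizedVolume P F j (vol F)

-- c(P), where vol is the volume function of P.
c : ∀ n → (Subset (suc n) → ℚ) → ℚ
c n vol = sum {suc n} λ j →
  fromℤ (-1ℤ ℤ.^ (n ∸ toℕ j)) * fromℕ (suc (toℕ j))
    * List.foldr _+_ 0ℚ (List.map vol (faces n (toℕ j)))

{-# OPTIONS --safe #-}

-- Call a point Σ ωᵢ (vᵢ , 1) of ℤⁿ⁺¹ with 0 ≤ ωᵢ < 1 a box point of P; its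
-- support is { i : ωᵢ ≠ 0 }.  Every lattice point of the cone over a face F is,
-- in a unique way, a box point with support in F plus a combination of the
-- (vᵢ , 1), i ∈ F, with coefficients in ℕ.  Counting at height k → ∞ shows that
-- Vol F is the number of box points with support in F.  Hence c(P) is the sum
-- over all box points, with support S say, of Σ_{F ⊇ S} (-1)^(n + 1 - ∣F∣) ∣F∣,
-- which is n + 1 if ∣S∣ = n + 1, is 1 if ∣S∣ = n, and is 0 otherwise.
-- The set of box points is only obtained up to double negation, which is
-- harmless because ≤ on ℚ is decidable.

module Submission where

open import Defs
open import Algebra.Bundles using (CommutativeRing)
open import Data.Bool.Base using (if_then_else_; not; true; false)
open import Data.Nat.Base as ℕ using (ℕ; zero; suc; _∸_; _!; _≡ᵇ_)
import Data.Nat.Properties as ℕ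
import Data.Nat.Solver as ℕSolver
open import Data.Integer.Base as ℤ using (ℤ; +_; 0ℤ; -1ℤ)
import Data.Integer.Properties as ℤ
open import Data.Rational.Base as ℚ
  using (ℚ; mkℚ; 0ℚ; 1ℚ; _+_; _-_; _*_; -_; _≤_; _<_; 1/_; toℚᵘ; positive; nonNegative)
import Data.Rational.Properties as ℚ
import Data.Rational.Unnormalised.Base as ℚᵘ
import Data.Rational.Unnormalised.Properties as ℚᵘ
open import Data.Rational.Solver using (module +-*-Solver)
open import Data.Fin.Base using (Fin; zero; suc; toℕ)
open import Data.Fin.Subset using (Subset; inside; outside; ∣_∣; _∉_; _⊆_; ⊤)
open import Data.Fin.Subset.Properties using (_⊆?_; _∈?_; ∈⊤; ∣⊤∣≡n; ∣p∣≤n)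
open import Data.Vec.Base as Vec using (Vec; lookup; []; _∷_; here; there; tabulate)
import Data.Vec.Properties as Vec
open import Data.List.Base as List using (List; []; _∷_; length; filter; _++_)
import Data.List.Properties as List
open import Data.List.Membership.Propositional using (_∈_)
open import Data.List.Membership.Propositional.Properties
open import Data.List.Relation.Unary.All as All using (All; []; _∷_)
import Data.List.Relation.Unary.All.Properties as All
open import Data.List.Relation.Unary.Any using (here; there)
open import Data.List.Relation.Unary.AllPairs using ([]; _∷_)
open import Data.List.Relation.Unary.Unique.Propositional using (Unique)
import Data.List.Relation.Unary.Unique.Propositional.Properties as Unique
open import Data.Product.Base using (_×_; _,_; ∃-syntax; proj₁; proj₂)
open import Data.Sum.Base using (inj₁; inj₂)
open import Function.Base using (_∘_)
open import Function.Bundles using (module Equivalence)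
open import Relation.Nullary
  using (does; yes; no; contradiction; DoubleNegation; decidable-stable; ¬¬-map; ¬¬-excluded-middle)
open import Relation.Binary.PropositionalEquality hiding (J)
open import Algebra.Properties.Semiring.Sum (CommutativeRing.semiring ℚ.+-*-commutativeRing)
  using (sum-cong-≗; ∑-distrib-+; *-distribˡ-sum; sum-replicate-zero)
import Algebra.Properties.Ring ℚ.+-*-ring as ℚRing
open import Algebra.Properties.CommutativeSemigroup ℕ.*-commutativeSemigroup using (x∙yz≈y∙xz)
open +-*-Solver using (solve; _:=_; _:+_; _:*_; _:-_; con)

-- Rational numbers and linear combinations

-- The volume of a face is known only as a Jordan content in some lattice frame, with no determinant
-- formula, and the frames of different faces are unrelated. Box points do not refer to frames, so
-- one finite set of them serves all faces at once. The bridge is a tile's lower corner. At scale k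
-- the corners are exactly the points of the lattice refined by k, so tiles correspond to lattice
-- points of k aff(F). A tile inside F has its corner in F, and a lattice point of kF is the scaled
-- corner of a tile that meets F. Hence the number of lattice points of kF lies between every
-- packing number and every covering number. For k ≥ n + 1, j ! times this number is the sum, over
-- the box points supported in F, of (k - h + 1) ... (k - h + j), where h is the height of the box
-- point. Each summand has leading term kʲ, so the content can only be the number of these box
-- points. Finiteness of the set of box points also comes from a covering, that of P itself. Which
-- tiles belong to box points is not decided; this is the source of the double negation.

toℚᵘ-fromℤ : ∀ z → toℚᵘ (fromℤ z) ℚᵘ.≃ ℚᵘ.mkℚᵘ z 0
toℚᵘ-fromℤ z = ℚ.toℚᵘ-fromℚᵘ (ℚᵘ.mkℚᵘ z 0)

fromℤ-homo-+ : ∀ x y → fromℤ (x ℤ.+ y) ≡ fromℤ x + fromℤ y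
fromℤ-homo-+ x y = ℚ.toℚᵘ-injective (begin
  toℚᵘ (fromℤ (x ℤ.+ y))                 ≈⟨ toℚᵘ-fromℤ (x ℤ.+ y) ⟩
  ℚᵘ.mkℚᵘ (x ℤ.+ y) 0                    ≈⟨ ℚᵘ.*≡* (cong (ℤ._* ℤ.1ℤ) (sym (cong₂ ℤ._+_ (ℤ.*-identityʳ x) (ℤ.*-identityʳ y)))) ⟩
  ℚᵘ.mkℚᵘ x 0 ℚᵘ.+ ℚᵘ.mkℚᵘ y 0           ≈⟨ ℚᵘ.+-cong (toℚᵘ-fromℤ x) (toℚᵘ-fromℤ y) ⟨
  toℚᵘ (fromℤ x) ℚᵘ.+ toℚᵘ (fromℤ y)     ≈⟨ ℚ.toℚᵘ-homo-+ (fromℤ x) (fromℤ y) ⟨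
  toℚᵘ (fromℤ x + fromℤ y)               ∎)
  where open ℚᵘ.≃-Reasoning

fromℤ-homo-* : ∀ x y → fromℤ (x ℤ.* y) ≡ fromℤ x * fromℤ y
fromℤ-homo-* x y = ℚ.toℚᵘ-injective (begin
  toℚᵘ (fromℤ (x ℤ.* y))                 ≈⟨ toℚᵘ-fromℤ (x ℤ.* y) ⟩
  ℚᵘ.mkℚᵘ x 0 ℚᵘ.* ℚᵘ.mkℚᵘ y 0           ≈⟨ ℚᵘ.*-cong (toℚᵘ-fromℤ x) (toℚᵘ-fromℤ y) ⟨
  toℚᵘ (fromℤ x) ℚᵘ.* toℚᵘ (fromℤ y)     ≈⟨ ℚ.toℚᵘ-homo-* (fromℤ x) (fromℤ y) ⟨
  toℚᵘ (fromℤ x * fromℤ y)               ∎)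
  where open ℚᵘ.≃-Reasoning

fromℤ-homo-neg : ∀ x → fromℤ (ℤ.- x) ≡ - fromℤ x
fromℤ-homo-neg x = begin
  fromℤ (ℤ.- x)                        ≡⟨ ℚRing.//-rightDividesʳ (fromℤ x) (fromℤ (ℤ.- x)) ⟨
  (fromℤ (ℤ.- x) + fromℤ x) - fromℤ x  ≡⟨ cong (_- fromℤ x) (fromℤ-homo-+ (ℤ.- x) x) ⟨
  fromℤ (ℤ.- x ℤ.+ x) - fromℤ x        ≡⟨ cong (λ t → fromℤ t - fromℤ x) (ℤ.+-inverseˡ x) ⟩
  0ℚ - fromℤ x                         ≡⟨ ℚ.+-identityˡ _ ⟩
  - fromℤ x                            ∎
  where open ≡-Reasoning

fromℤ-mono-≤ : ∀ {x y} → x ℤ.≤ y → fromℤ x ≤ fromℤ y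
fromℤ-mono-≤ {x} {y} x≤y = ℚ.toℚᵘ-cancel-≤ (begin
  toℚᵘ (fromℤ x)  ≃⟨ toℚᵘ-fromℤ x ⟩
  ℚᵘ.mkℚᵘ x 0     ≤⟨ ℚᵘ.*≤* (ℤ.*-monoʳ-≤-nonNeg (+ 1) x≤y) ⟩
  ℚᵘ.mkℚᵘ y 0     ≃⟨ toℚᵘ-fromℤ y ⟨
  toℚᵘ (fromℤ y)  ∎)
  where open ℚᵘ.≤-Reasoning

fromℤ-mono-< : ∀ {x y} → x ℤ.< y → fromℤ x < fromℤ y
fromℤ-mono-< {x} {y} x<y = ℚ.toℚᵘ-cancel-< (begin-strict
  toℚᵘ (fromℤ x)  ≃⟨ toℚᵘ-fromℤ x ⟩
  ℚᵘ.mkℚᵘ x 0     <⟨ ℚᵘ.*<* (ℤ.*-monoʳ-<-pos (+ 1) x<y) ⟩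
  ℚᵘ.mkℚᵘ y 0     ≃⟨ toℚᵘ-fromℤ y ⟨
  toℚᵘ (fromℤ y)  ∎)
  where open ℚᵘ.≤-Reasoning

fromℕ-homo-+ : ∀ x y → fromℕ (x ℕ.+ y) ≡ fromℕ x + fromℕ y
fromℕ-homo-+ x y = fromℤ-homo-+ (+ x) (+ y)

fromℕ-homo-* : ∀ x y → fromℕ (x ℕ.* y) ≡ fromℕ x * fromℕ y
fromℕ-homo-* x y = trans (cong fromℤ (ℤ.pos-* x y)) (fromℤ-homo-* (+ x) (+ y))

fromℕ-mono-≤ : ∀ {x y} → x ℕ.≤ y → fromℕ x ≤ fromℕ y
fromℕ-mono-≤ x≤y = fromℤ-mono-≤ (ℤ.+≤+ x≤y)

fromℕ-mono-< : ∀ {x y} → x ℕ.< y → fromℕ x < fromℕ y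
fromℕ-mono-< x<y = fromℤ-mono-< (ℤ.+<+ x<y)

0≤fromℕ : ∀ x → 0ℚ ≤ fromℕ x
0≤fromℕ x = fromℕ-mono-≤ (ℕ.z≤n {x})

fromℕ-cancel-≤ : ∀ {x y} → fromℕ x ≤ fromℕ y → x ℕ.≤ y
fromℕ-cancel-≤ {x} {y} p with x ℕ.≤? y
... | yes x≤y = x≤y
... | no x≰y = contradiction (ℚ.<-≤-trans (fromℕ-mono-< (ℕ.≰⇒> x≰y)) p) (ℚ.<-irrefl refl)

fromℕ-injective : ∀ {x y} → fromℕ x ≡ fromℕ y → x ≡ y
fromℕ-injective e = ℕ.≤-antisym (fromℕ-cancel-≤ (ℚ.≤-reflexive e)) (fromℕ-cancel-≤ (ℚ.≤-reflexive (sym e)))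

archimedean : ∀ q → ∃[ N ] q < fromℕ N
archimedean q@(mkℚ p d _) = suc ℤ.∣ p ∣ , ℚ.toℚᵘ-cancel-< (begin-strict
  toℚᵘ q                          <⟨ ℚᵘ.*<* bound ⟩
  ℚᵘ.mkℚᵘ (+ suc ℤ.∣ p ∣) 0       ≃⟨ toℚᵘ-fromℤ (+ suc ℤ.∣ p ∣) ⟨
  toℚᵘ (fromℕ (suc ℤ.∣ p ∣))      ∎)
  where
  open ℚᵘ.≤-Reasoning
  i≤∣i∣ : ∀ i → i ℤ.≤ + ℤ.∣ i ∣
  i≤∣i∣ (+ _) = ℤ.≤-refl
  i≤∣i∣ ℤ.-[1+ _ ] = ℤ.-≤+
  bound : p ℤ.* + 1 ℤ.< + suc ℤ.∣ p ∣ ℤ.* + suc d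
  bound = subst₂ ℤ._<_ (sym (ℤ.*-identityʳ p)) (ℤ.pos-* (suc ℤ.∣ p ∣) (suc d))
    (ℤ.≤-<-trans (i≤∣i∣ p) (ℤ.+<+ (ℕ.m≤m*n (suc ℤ.∣ p ∣) (suc d))))

floor : ∀ q → 0ℚ ≤ q → ∃[ m ] (0ℚ ≤ q - fromℕ m × q - fromℕ m < 1ℚ)
floor q 0≤q = let N , q<N = archimedean q in go N q 0≤q q<N
  where
  shift : ∀ q m → (q - 1ℚ) - m ≡ q - (1ℚ + m)
  shift = solve 2 (λ q m → (q :- con 1ℚ) :- m := q :- (con 1ℚ :+ m)) refl
  cancel : ∀ x → (1ℚ + x) - 1ℚ ≡ x
  cancel = solve 1 (λ x → (con 1ℚ :+ x) :- con 1ℚ := x) refl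
  -- Subtracts 1 while the remainder is at least 1; the Archimedean bound `N` is the fuel.
  go : ∀ N q → 0ℚ ≤ q → q < fromℕ N → ∃[ m ] (0ℚ ≤ q - fromℕ m × q - fromℕ m < 1ℚ)
  go zero q 0≤q q<0 = contradiction (ℚ.≤-<-trans 0≤q q<0) (ℚ.<-irrefl refl)
  go (suc N) q 0≤q q<N with q ℚ.<? 1ℚ
  ... | yes q<1 = 0 , subst (λ t → 0ℚ ≤ t × t < 1ℚ) (sym (ℚ.+-identityʳ q)) (0≤q , q<1)
  ... | no q≮1 = let m , r = go N (q - 1ℚ)
                       (subst (_≤ q - 1ℚ) (ℚ.+-inverseʳ 1ℚ) (ℚ.+-monoˡ-≤ (- 1ℚ) (ℚ.≮⇒≥ q≮1)))
                       (subst (q - 1ℚ <_) (trans (cong (_- 1ℚ) (fromℕ-homo-+ 1 N)) (cancel (fromℕ N))) (ℚ.+-monoˡ-< (- 1ℚ) q<N))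
                 in suc m , subst (λ t → 0ℚ ≤ t × t < 1ℚ)
                       (trans (shift q (fromℕ m)) (cong (λ t → q - t) (sym (fromℕ-homo-+ 1 m)))) r

-- If x < y, then x + 1 ≤ y already exceeds the left side. Used twice with the sides exchanged, this
-- makes integer parts unique.
floor-unique : ∀ {a b} x y → a < 1ℚ → 0ℚ ≤ b → a + fromℕ x ≡ b + fromℕ y → y ℕ.≤ x
floor-unique {a} {b} x y a<1 0≤b e with y ℕ.≤? x
... | yes y≤x = y≤x
... | no y≰x = contradiction (begin-strict
    a + fromℕ x       <⟨ ℚ.+-monoˡ-< (fromℕ x) a<1 ⟩
    1ℚ + fromℕ x      ≡⟨ fromℕ-homo-+ 1 x ⟨
    fromℕ (suc x)     ≤⟨ fromℕ-mono-≤ (ℕ.≰⇒> y≰x) ⟩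
    fromℕ y           ≡⟨ ℚ.+-identityˡ _ ⟨
    0ℚ + fromℕ y      ≤⟨ ℚ.+-monoˡ-≤ (fromℕ y) 0≤b ⟩
    b + fromℕ y       ≡⟨ e ⟨
    a + fromℕ x       ∎) (ℚ.<-irrefl refl)
  where open ℚ.≤-Reasoning

sum-* : ∀ {m} c (f : Fin m → ℚ) → sum (λ i → c * f i) ≡ c * sum f
sum-* c f = sym (*-distribˡ-sum c f)

sum-mono-≤ : ∀ {m} {f g : Fin m → ℚ} → (∀ i → f i ≤ g i) → sum f ≤ sum g
sum-mono-≤ {zero} p = ℚ.≤-refl
sum-mono-≤ {suc m} p = ℚ.+-mono-≤ (p zero) (sum-mono-≤ (p ∘ suc))

sum-1 : ∀ m → sum {m} (λ _ → 1ℚ) ≡ fromℕ m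
sum-1 zero = refl
sum-1 (suc m) = trans (cong (_+_ 1ℚ) (sum-1 m)) (sym (fromℕ-homo-+ 1 m))

combination-+ : ∀ {m n} (μ ν : Fin m → ℚ) (v : Fin m → LatticePoint n) a →
  combination (λ i → μ i + ν i) v a ≡ combination μ v a + combination ν v a
combination-+ μ ν v a = trans
  (sum-cong-≗ (λ i → ℚ.*-distribʳ-+ (fromℤ (v i a)) (μ i) (ν i)))
  (∑-distrib-+ (λ i → μ i * fromℤ (v i a)) (λ i → ν i * fromℤ (v i a)))

combination-* : ∀ {m n} c (μ : Fin m → ℚ) (v : Fin m → LatticePoint n) a →
  combination (λ i → c * μ i) v a ≡ c * combination μ v a
combination-* c μ v a = trans
  (sum-cong-≗ (λ i → ℚ.*-assoc c (μ i) (fromℤ (v i a))))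
  (sum-* c (λ i → μ i * fromℤ (v i a)))

combination-cong : ∀ {m n} {μ ν : Fin m → ℚ} (v : Fin m → LatticePoint n) a →
  (∀ i → μ i ≡ ν i) → combination μ v a ≡ combination ν v a
combination-cong v a p = sum-cong-≗ (λ i → cong (_* fromℤ (v i a)) (p i))

Integral : ℚ → Set
Integral q = ∃[ z ] q ≡ fromℤ z

integral-+ : ∀ {p q} → Integral p → Integral q → Integral (p + q)
integral-+ (x , refl) (y , refl) = x ℤ.+ y , sym (fromℤ-homo-+ x y)

integral-* : ∀ {p q} → Integral p → Integral q → Integral (p * q)
integral-* (x , refl) (y , refl) = x ℤ.* y , sym (fromℤ-homo-* x y)

integral-neg : ∀ {p} → Integral p → Integral (- p)
integral-neg (x , refl) = ℤ.- x , sym (fromℤ-homo-neg x)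

integral-sum : ∀ {m} (f : Fin m → ℚ) → (∀ i → Integral (f i)) → Integral (sum f)
integral-sum {zero} f p = 0ℤ , refl
integral-sum {suc m} f p = integral-+ (p zero) (integral-sum (f ∘ suc) (p ∘ suc))

integral-combination : ∀ {m n} (μ : Fin m → ℚ) (v : Fin m → LatticePoint n) a →
  (∀ i → Integral (μ i)) → Integral (combination μ v a)
integral-combination μ v a p = integral-sum _ (λ i → integral-* (p i) (v i a , refl))

integral-nonNeg : ∀ {q} → Integral q → 0ℚ ≤ q → ∃[ m ] q ≡ fromℕ m
integral-nonNeg (+ m , e) _ = m , e
integral-nonNeg (ℤ.-[1+ m ] , refl) 0≤q =
  contradiction (ℚ.≤-<-trans 0≤q (fromℤ-mono-< (ℤ.-<+ {m} {0}))) (ℚ.<-irrefl refl)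

-- This is (1 - a/s)ʲ ≥ 1 - j a/s for s = k + a, multiplied by sʲ⁺¹ so that neither subtraction nor
-- the exponent j - 1 occurs.
bernoulli : ∀ k a j →
  (k ℕ.+ a) ℕ.^ j ℕ.* (k ℕ.+ a) ℕ.≤ k ℕ.^ j ℕ.* (k ℕ.+ a) ℕ.+ j ℕ.* a ℕ.* (k ℕ.+ a) ℕ.^ j
bernoulli k a zero = ℕ.m≤m+n _ _
bernoulli k a (suc j) = begin
  s ℕ.* S ℕ.* s                                               ≡⟨ ring₁ s S ⟩
  s ℕ.* (S ℕ.* s)                                             ≤⟨ ℕ.*-monoʳ-≤ s (bernoulli k a j) ⟩
  s ℕ.* (K ℕ.* s ℕ.+ j ℕ.* a ℕ.* S)                           ≡⟨ ring₂ k a K j S ⟩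
  k ℕ.* K ℕ.* s ℕ.+ (a ℕ.* K ℕ.* s ℕ.+ j ℕ.* a ℕ.* (s ℕ.* S)) ≤⟨ ℕ.+-monoʳ-≤ (k ℕ.* K ℕ.* s) (ℕ.+-monoˡ-≤ _ (ℕ.*-monoˡ-≤ s (ℕ.*-monoʳ-≤ a (ℕ.^-monoˡ-≤ j (ℕ.m≤m+n k a))))) ⟩
  k ℕ.* K ℕ.* s ℕ.+ (a ℕ.* S ℕ.* s ℕ.+ j ℕ.* a ℕ.* (s ℕ.* S)) ≡⟨ cong (k ℕ.* K ℕ.* s ℕ.+_) (ring₃ s S a j) ⟩
  k ℕ.* K ℕ.* s ℕ.+ suc j ℕ.* a ℕ.* (s ℕ.* S)                 ∎
  where
  open ℕ.≤-Reasoning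
  import Data.Nat.Solver as ℕSolver
  open ℕSolver.+-*-Solver renaming (solve to solveℕ; _:=_ to _:≡_; _:+_ to _⊕_; _:*_ to _⊗_; con to conℕ)
  s = k ℕ.+ a
  S = s ℕ.^ j
  K = k ℕ.^ j
  ring₁ : ∀ s S → s ℕ.* S ℕ.* s ≡ s ℕ.* (S ℕ.* s)
  ring₁ s S = ℕ.*-assoc s S s
  ring₂ : ∀ k a K j S → (k ℕ.+ a) ℕ.* (K ℕ.* (k ℕ.+ a) ℕ.+ j ℕ.* a ℕ.* S) ≡
    k ℕ.* K ℕ.* (k ℕ.+ a) ℕ.+ (a ℕ.* K ℕ.* (k ℕ.+ a) ℕ.+ j ℕ.* a ℕ.* ((k ℕ.+ a) ℕ.* S))
  ring₂ = solveℕ 5 (λ k a K j S → (k ⊕ a) ⊗ (K ⊗ (k ⊕ a) ⊕ j ⊗ a ⊗ S) :≡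
    k ⊗ K ⊗ (k ⊕ a) ⊕ (a ⊗ K ⊗ (k ⊕ a) ⊕ j ⊗ a ⊗ ((k ⊕ a) ⊗ S))) refl
  ring₃ : ∀ s S a j → a ℕ.* S ℕ.* s ℕ.+ j ℕ.* a ℕ.* (s ℕ.* S) ≡ suc j ℕ.* a ℕ.* (s ℕ.* S)
  ring₃ = solveℕ 4 (λ s S a j → a ⊗ S ⊗ s ⊕ j ⊗ a ⊗ (s ⊗ S) :≡ (conℕ 1 ⊕ j) ⊗ a ⊗ (s ⊗ S)) refl

archimedean-* : ∀ {δ} q K → 0ℚ < δ → ∃[ k ] (K ℕ.≤ k × q < δ * fromℕ k)
archimedean-* {δ} q K 0<δ = K ℕ.+ N , ℕ.m≤m+n K N , (begin-strict
  q                       ≡⟨ ℚ.*-identityˡ q ⟨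
  1ℚ * q                  ≡⟨ cong (_* q) (ℚ.*-inverseʳ δ) ⟨
  δ * δ⁻¹ * q             ≡⟨ ℚ.*-assoc δ δ⁻¹ q ⟩
  δ * (δ⁻¹ * q)           <⟨ ℚ.*-monoʳ-<-pos δ q/δ<N ⟩
  δ * fromℕ N             ≤⟨ ℚ.*-monoˡ-≤-nonNeg δ (fromℕ-mono-≤ (ℕ.m≤n+m N K)) ⟩
  δ * fromℕ (K ℕ.+ N)     ∎)
  where
  open ℚ.≤-Reasoning
  instance
    δ>0 = positive 0<δ
    δ≠0 = ℚ.pos⇒nonZero δ
    δ≥0 = ℚ.pos⇒nonNeg δ
  δ⁻¹ = 1/ δ
  N = proj₁ (archimedean (δ⁻¹ * q))
  q/δ<N = proj₂ (archimedean (δ⁻¹ * q))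

-- If P > Q, Bernoulli's inequality (k + a)ʲ ≤ kʲ + j a (k + a)ʲ⁻¹ bounds k.
leading-≤ : ∀ {P Q} a j K → 0ℚ ≤ P →
  (∀ k → K ℕ.≤ k → P * fromℕ (k ℕ.^ j) ≤ Q * fromℕ ((k ℕ.+ a) ℕ.^ j)) → P ≤ Q
leading-≤ {P} {Q} a j K 0≤P asym with P ℚ.≤? Q
... | yes P≤Q = P≤Q
... | no P≰Q = contradiction (ℚ.<-≤-trans (ℚ.<-≤-trans Pja<δk δk≤δs) δs≤Pja) (ℚ.<-irrefl refl)
  where
  open ℚ.≤-Reasoning
  0<δ : 0ℚ < P - Q
  0<δ = subst (_< P - Q) (ℚ.+-inverseʳ Q) (ℚ.+-monoˡ-< (- Q) (ℚ.≰⇒> P≰Q))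
  J = fromℕ (j ℕ.* a)
  -- The bound `suc K` gives both k ≥ K, for `asym`, and k > 0, so that sʲ is positive and can be
  -- cancelled.
  big = archimedean-* (P * J) (suc K) 0<δ
  k = proj₁ big
  s = k ℕ.+ a
  0<s : 0 ℕ.< s
  0<s = ℕ.<-≤-trans (ℕ.<-≤-trans ℕ.z<s (proj₁ (proj₂ big))) (ℕ.m≤m+n k a)
  instance
    P≥0 = nonNegative 0≤P
    δ≥0 = nonNegative (ℚ.<⇒≤ 0<δ)
    s≥0 = nonNegative (0≤fromℕ s)
    s≠0 = ℕ.>-nonZero 0<s
    s^j>0 = positive (fromℕ-mono-< (ℕ.m^n>0 s j))
  Pja<δk = proj₂ (proj₂ big)
  δk≤δs = ℚ.*-monoˡ-≤-nonNeg (P - Q) (fromℕ-mono-≤ (ℕ.m≤m+n k a))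
  S = fromℕ (s ℕ.^ j)
  expand : ∀ P Q s S → (P - Q) * s * S ≡ P * (S * s) - Q * S * s
  expand = solve 4 (λ P Q s S → (P :- Q) :* s :* S := P :* (S :* s) :- Q :* S :* s) refl
  collect : ∀ P Q κ s S J → P * (κ * s + J * S) - Q * S * s ≡ (P * κ - Q * S) * s + P * J * S
  collect = solve 6 (λ P Q κ s S J → P :* (κ :* s :+ J :* S) :- Q :* S :* s := (P :* κ :- Q :* S) :* s :+ P :* J :* S) refl
  bernoulliℚ : S * fromℕ s ≤ fromℕ (k ℕ.^ j) * fromℕ s + J * S
  bernoulliℚ = subst₂ _≤_ (fromℕ-homo-* (s ℕ.^ j) s)
    (trans (fromℕ-homo-+ (k ℕ.^ j ℕ.* s) (j ℕ.* a ℕ.* s ℕ.^ j)) (cong₂ _+_ (fromℕ-homo-* (k ℕ.^ j) s) (fromℕ-homo-* (j ℕ.* a) (s ℕ.^ j))))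
    (fromℕ-mono-≤ (bernoulli k a j))
  diff≤0 : P * fromℕ (k ℕ.^ j) - Q * S ≤ 0ℚ
  diff≤0 = subst (P * fromℕ (k ℕ.^ j) - Q * S ≤_) (ℚ.+-inverseʳ (Q * S))
    (ℚ.+-monoˡ-≤ (- (Q * S)) (asym k (ℕ.≤-trans (ℕ.n≤1+n K) (proj₁ (proj₂ big)))))
  δs≤Pja : (P - Q) * fromℕ s ≤ P * J
  δs≤Pja = ℚ.*-cancelʳ-≤-pos S (begin
    (P - Q) * fromℕ s * S                                  ≡⟨ expand P Q (fromℕ s) S ⟩
    P * (S * fromℕ s) - Q * S * fromℕ s                    ≤⟨ ℚ.+-monoˡ-≤ (- (Q * S * fromℕ s)) (ℚ.*-monoˡ-≤-nonNeg P bernoulliℚ) ⟩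
    P * (fromℕ (k ℕ.^ j) * fromℕ s + J * S) - Q * S * fromℕ s ≡⟨ collect P Q (fromℕ (k ℕ.^ j)) (fromℕ s) S J ⟩
    (P * fromℕ (k ℕ.^ j) - Q * S) * fromℕ s + P * J * S    ≤⟨ ℚ.+-monoˡ-≤ (P * J * S) (ℚ.*-monoʳ-≤-nonNeg (fromℕ s) diff≤0) ⟩
    0ℚ * fromℕ s + P * J * S                               ≡⟨ cong (_+ P * J * S) (ℚ.*-zeroˡ (fromℕ s)) ⟩
    0ℚ + P * J * S                                         ≡⟨ ℚ.+-identityˡ _ ⟩
    P * J * S                                              ∎)

≤-+-ε : ∀ {p q} → (∀ ε → 0ℚ < ε → p ≤ q + ε) → p ≤ q
≤-+-ε {p} {q} h with p ℚ.≤? q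
... | yes p≤q = p≤q
... | no p≰q = let r , q<r , r<p = ℚ.<-dense (ℚ.≰⇒> p≰q) in
    contradiction (ℚ.<-≤-trans r<p (subst (p ≤_) (cancel q r)
      (h (r - q) (subst (_< r - q) (ℚ.+-inverseʳ q) (ℚ.+-monoˡ-< (- q) q<r))))) (ℚ.<-irrefl refl)
  where
  cancel : ∀ q r → q + (r - q) ≡ r
  cancel = solve 2 (λ q r → q :+ (r :- q) := r) refl

-- Finite enumerations and compositions

-- Pigeonhole by removing the partner of the head from `ys`: injectivity keeps it from being the
-- partner of a later element. A relation takes the place of a function so that one correspondence
-- between lattice points and tiles can be used in both directions.
length-≤-by-injection : ∀ {A B : Set} (R : A → B → Set) {xs : List A} {ys : List B} → Unique xs →
  (∀ {x} → x ∈ xs → ∃[ y ] y ∈ ys × R x y) →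
  (∀ {x x′ y} → x ∈ xs → x′ ∈ xs → R x y → R x′ y → x ≡ x′) →
  length xs ℕ.≤ length ys
length-≤-by-injection R {[]} [] total inj = ℕ.z≤n
length-≤-by-injection R {x ∷ xs} (x∉xs ∷ uxs) total inj with total (here refl)
... | y , y∈ys , xRy with ∈-∃++ y∈ys
... | as , bs , refl = subst (suc (length xs) ℕ.≤_) (sym length-ys)
      (ℕ.s≤s (length-≤-by-injection R {xs} {as ++ bs} uxs total′ λ p q → inj (there p) (there q)))
  where
  length-ys : length (as ++ y ∷ bs) ≡ suc (length (as ++ bs))
  length-ys = trans (List.length-++ as) (trans (ℕ.+-suc _ _) (cong suc (sym (List.length-++ as))))
  total′ : ∀ {x′} → x′ ∈ xs → ∃[ y′ ] y′ ∈ as ++ bs × R x′ y′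
  total′ x′∈xs with total (there x′∈xs)
  ... | y′ , y′∈ys , x′Ry′ with ∈-++⁻ as y′∈ys
  ... | inj₁ y′∈as = y′ , ∈-++⁺ˡ y′∈as , x′Ry′
  ... | inj₂ (there y′∈bs) = y′ , ∈-++⁺ʳ as y′∈bs , x′Ry′
  ... | inj₂ (here refl) = contradiction (inj (here refl) (there x′∈xs) xRy x′Ry′) (All.lookup x∉xs x′∈xs)

-- `P` may be undecidable, but excluded middle is irrefutable and is invoked only finitely often:
-- for each label in `ys`, ask whether some element of `P` carries it. By injectivity there is at
-- most one.
¬¬-enumeration : ∀ {A B : Set} (P : A → Set) (R : A → B → Set) (ys : List B) →
  (∀ {x} → P x → ∃[ y ] y ∈ ys × R x y) →
  (∀ {x x′ y} → P x → P x′ → R x y → R x′ y → x ≡ x′) →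
  DoubleNegation (∃[ xs ] Unique xs × All P xs × (∀ {x} → P x → x ∈ xs))
¬¬-enumeration {A} {B} P R ys total inj =
  ¬¬-map (λ (xs , u , p , complete) → xs , u , p , λ {x} Px → complete Px (proj₁ (proj₂ (total Px))) (proj₂ (proj₂ (total Px)))) (go ys)
  where
  Enumeration : List B → Set
  Enumeration ys = ∃[ xs ] Unique xs × All P xs × (∀ {x y} → P x → y ∈ ys → R x y → x ∈ xs)
  go : ∀ ys → DoubleNegation (Enumeration ys)
  go [] k = k ([] , [] , [] , λ _ ())
  go (y ∷ ys) k = go ys λ (xs , u , p , complete) → ¬¬-excluded-middle {A = ∃[ x ] P x × R x y} λ where
    (no ∄x) → k (xs , u , p , λ where
      Px (here refl) r → contradiction (_ , Px , r) ∄x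
      Px (there y∈ys) r → complete Px y∈ys r)
    -- An element may carry several labels, so it may have been listed already.
    (yes (x , Px , r)) → ¬¬-excluded-middle {A = x ∈ xs} λ where
      (yes x∈xs) → k (xs , u , p , λ where
        Px′ (here refl) r′ → subst (_∈ xs) (inj Px Px′ r r′) x∈xs
        Px′ (there y∈ys) r′ → complete Px′ y∈ys r′)
      (no x∉xs) → k (x ∷ xs , All.tabulate (λ x′∈xs e → x∉xs (subst (_∈ xs) (sym e) x′∈xs)) ∷ u , Px ∷ p , λ where
        Px′ (here refl) r′ → here (inj Px′ Px r′ r)
        Px′ (there y∈ys) r′ → there (complete Px′ y∈ys r′))

-- Compositions of a number with prescribed support

incrementHead : ∀ {m} → Vec ℕ (suc m) → Vec ℕ (suc m)
incrementHead (x ∷ xs) = suc x ∷ xs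

compositions : ∀ {m} → Subset m → ℕ → List (Vec ℕ m)
compositions []            zero    = List.[ [] ]
compositions []            (suc K) = []
compositions (outside ∷ F) K       = List.map (0 ∷_) (compositions F K)
compositions (inside ∷ F)  zero    = List.map (0 ∷_) (compositions F zero)
compositions (inside ∷ F)  (suc K) =
  List.map (0 ∷_) (compositions F (suc K)) ++ List.map incrementHead (compositions (inside ∷ F) K)

VanishesOff : ∀ {m} → Subset m → Vec ℕ m → Set
VanishesOff F xs = ∀ i → i ∉ F → lookup xs i ≡ 0

vanishes-∷ : ∀ {m} {b F} {xs : Vec ℕ m} → VanishesOff F xs → VanishesOff (b ∷ F) (0 ∷ xs)
vanishes-∷ p zero    _   = refl
vanishes-∷ p (suc i) i∉F = p i λ i∈F → i∉F (there i∈F)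

vanishes-tail : ∀ {m} {b F x} {xs : Vec ℕ m} → VanishesOff (b ∷ F) (x ∷ xs) → VanishesOff F xs
vanishes-tail p i i∉F = p (suc i) λ { (there i∈F) → i∉F i∈F }

vanishes-incrementHead : ∀ {m} {F : Subset m} xs → VanishesOff (inside ∷ F) xs → VanishesOff (inside ∷ F) (incrementHead xs)
vanishes-incrementHead (_ ∷ _) v zero    0∉F = contradiction here 0∉F
vanishes-incrementHead (_ ∷ _) v (suc i)     = v (suc i)

sum-incrementHead : ∀ {m} (xs : Vec ℕ (suc m)) → Vec.sum (incrementHead xs) ≡ suc (Vec.sum xs)
sum-incrementHead (_ ∷ _) = refl

compositions-sound : ∀ {m} (F : Subset m) K → All (λ xs → Vec.sum xs ≡ K × VanishesOff F xs) (compositions F K)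
compositions-sound [] zero = (refl , λ ()) ∷ []
compositions-sound [] (suc K) = []
compositions-sound (outside ∷ F) K =
  All.map⁺ (All.map (λ (s , v) → s , vanishes-∷ v) (compositions-sound F K))
compositions-sound (inside ∷ F) zero =
  All.map⁺ (All.map (λ (s , v) → s , vanishes-∷ v) (compositions-sound F zero))
compositions-sound (inside ∷ F) (suc K) = All.++⁺
  (All.map⁺ (All.map (λ (s , v) → s , vanishes-∷ v) (compositions-sound F (suc K))))
  (All.map⁺ (All.map (λ {xs} (s , v) → trans (sum-incrementHead xs) (cong suc s) , vanishes-incrementHead xs v)
    (compositions-sound (inside ∷ F) K)))

compositions-complete : ∀ {m} (F : Subset m) K xs → Vec.sum xs ≡ K → VanishesOff F xs → xs ∈ compositions F K
compositions-complete [] zero [] refl v = here refl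
compositions-complete (outside ∷ F) K (x ∷ xs) s v with v zero (λ ())
... | refl = ∈-map⁺ (0 ∷_) (compositions-complete F K xs s (vanishes-tail v))
compositions-complete (inside ∷ F) zero (zero ∷ xs) s v =
  ∈-map⁺ (0 ∷_) (compositions-complete F zero xs s (vanishes-tail v))
compositions-complete (inside ∷ F) (suc K) (zero ∷ xs) s v =
  ∈-++⁺ˡ (∈-map⁺ (0 ∷_) (compositions-complete F (suc K) xs s (vanishes-tail v)))
compositions-complete (inside ∷ F) (suc K) (suc x ∷ xs) s v =
  ∈-++⁺ʳ (List.map (0 ∷_) (compositions F (suc K))) (∈-map⁺ incrementHead
    (compositions-complete (inside ∷ F) K (x ∷ xs) (ℕ.suc-injective s)
      λ { zero 0∉F → contradiction here 0∉F ; (suc i) → v (suc i) }))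

compositions-unique : ∀ {m} (F : Subset m) K → Unique (compositions F K)
compositions-unique [] zero = [] ∷ []
compositions-unique [] (suc K) = []
compositions-unique (outside ∷ F) K = Unique.map⁺ Vec.∷-injectiveʳ (compositions-unique F K)
compositions-unique (inside ∷ F) zero = Unique.map⁺ Vec.∷-injectiveʳ (compositions-unique F zero)
compositions-unique (inside ∷ F) (suc K) = Unique.++⁺
  (Unique.map⁺ Vec.∷-injectiveʳ (compositions-unique F (suc K)))
  (Unique.map⁺ incrementHead-injective (compositions-unique (inside ∷ F) K))
  λ (p , q) → disjoint (proj₂ (proj₂ (∈-map⁻ (0 ∷_) p))) (proj₂ (proj₂ (∈-map⁻ incrementHead q)))
  where
  incrementHead-injective : ∀ {m} {xs ys : Vec ℕ (suc m)} → incrementHead xs ≡ incrementHead ys → xs ≡ ys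
  incrementHead-injective {xs = _ ∷ _} {_ ∷ _} refl = refl
  disjoint : ∀ {m} {xs : Vec ℕ m} {ys zs} → zs ≡ 0 ∷ xs → zs ≢ incrementHead ys
  disjoint {ys = _ ∷ _} refl ()

-- The binomial coefficient "K + j - 1 over K", by Pascal's rule along the recursion of
-- `compositions`.
compositionCount : ℕ → ℕ → ℕ
compositionCount zero    zero    = 1
compositionCount zero    (suc K) = 0
compositionCount (suc j) zero    = compositionCount j zero
compositionCount (suc j) (suc K) = compositionCount j (suc K) ℕ.+ compositionCount (suc j) K

length-compositions : ∀ {m} (F : Subset m) K → length (compositions F K) ≡ compositionCount ∣ F ∣ K
length-compositions [] zero = refl
length-compositions [] (suc K) = refl
length-compositions (outside ∷ F) K = trans (List.length-map (0 ∷_) (compositions F K)) (length-compositions F K)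
length-compositions (inside ∷ F) zero = trans (List.length-map (0 ∷_) (compositions F zero)) (length-compositions F zero)
length-compositions (inside ∷ F) (suc K) = trans (List.length-++ (List.map (0 ∷_) (compositions F (suc K))))
  (cong₂ ℕ._+_
    (trans (List.length-map (0 ∷_) (compositions F (suc K))) (length-compositions F (suc K)))
    (trans (List.length-map incrementHead (compositions (inside ∷ F) K)) (length-compositions (inside ∷ F) K)))

-- The product (K + 1)(K + 2) ... (K + j).
rising : ℕ → ℕ → ℕ
rising zero    K = 1
rising (suc j) K = (K ℕ.+ suc j) ℕ.* rising j K

-- Splits off the smallest factor, where the definition splits off the largest. This exposes the
-- factor common to both terms of Pascal's rule in `!*compositionCount`.
rising-shift : ∀ j K → rising (suc j) K ≡ suc K ℕ.* rising j (suc K)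
rising-shift zero K = cong (ℕ._* 1) (ℕ.+-comm K 1)
rising-shift (suc j) K = begin
  (K ℕ.+ suc (suc j)) ℕ.* rising (suc j) K                ≡⟨ cong₂ ℕ._*_ (ℕ.+-suc K (suc j)) (rising-shift j K) ⟩
  (suc K ℕ.+ suc j) ℕ.* (suc K ℕ.* rising j (suc K))      ≡⟨ x∙yz≈y∙xz (suc K ℕ.+ suc j) (suc K) (rising j (suc K)) ⟩
  suc K ℕ.* rising (suc j) (suc K)                        ∎
  where open ≡-Reasoning

!*compositionCount : ∀ j K → j ! ℕ.* compositionCount (suc j) K ≡ rising j K
!*compositionCount zero zero = refl
!*compositionCount zero (suc K) = !*compositionCount zero K
!*compositionCount (suc j) zero = trans (ℕ.*-assoc (suc j) (j !) _) (cong (suc j ℕ.*_) (!*compositionCount j zero))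
!*compositionCount (suc j) (suc K) = begin
  (suc j) ! ℕ.* (compositionCount (suc j) (suc K) ℕ.+ compositionCount (suc (suc j)) K)
    ≡⟨ ℕ.*-distribˡ-+ ((suc j) !) _ _ ⟩
  (suc j) ! ℕ.* compositionCount (suc j) (suc K) ℕ.+ (suc j) ! ℕ.* compositionCount (suc (suc j)) K
    ≡⟨ cong₂ ℕ._+_ (trans (ℕ.*-assoc (suc j) (j !) _) (cong (suc j ℕ.*_) (!*compositionCount j (suc K)))) (!*compositionCount (suc j) K) ⟩
  suc j ℕ.* rising j (suc K) ℕ.+ rising (suc j) K
    ≡⟨ cong (suc j ℕ.* rising j (suc K) ℕ.+_) (rising-shift j K) ⟩
  suc j ℕ.* rising j (suc K) ℕ.+ suc K ℕ.* rising j (suc K)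
    ≡⟨ ℕ.*-distribʳ-+ (rising j (suc K)) (suc j) (suc K) ⟨
  (suc j ℕ.+ suc K) ℕ.* rising j (suc K)
    ≡⟨ cong (ℕ._* rising j (suc K)) (ℕ.+-comm (suc j) (suc K)) ⟩
  rising (suc j) (suc K) ∎
  where open ≡-Reasoning

^≤rising : ∀ j K → K ℕ.^ j ℕ.≤ rising j K
^≤rising zero K = ℕ.≤-refl
^≤rising (suc j) K = ℕ.*-mono-≤ (ℕ.m≤m+n K (suc j)) (^≤rising j K)

rising≤^ : ∀ j K b → j ℕ.≤ b → rising j K ℕ.≤ (K ℕ.+ b) ℕ.^ j
rising≤^ zero K b j≤b = ℕ.≤-refl
rising≤^ (suc j) K b j<b = ℕ.*-mono-≤ (ℕ.+-monoʳ-≤ K j<b) (rising≤^ j K b (ℕ.<⇒≤ j<b))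

-- Counting the translates of box points at height k

module _ {A : Set} (height : A → ℕ) {m} (F : Subset m) (k : ℕ) where

  -- When `height g` exceeds k, truncated subtraction leaves one spurious entry, with the zero
  -- composition. It is harmless in upper bounds for the content; the lower bounds use only k ≥ n +
  -- 1, where it does not occur.
  translates : List A → List (A × Vec ℕ m)
  translates []       = []
  translates (g ∷ gs) = List.map (g ,_) (compositions F (k ∸ height g)) ++ translates gs

  ∈-translates⁺ : ∀ {gs g xs} → g ∈ gs → xs ∈ compositions F (k ∸ height g) → (g , xs) ∈ translates gs
  ∈-translates⁺ {g ∷ gs} (here refl) xs∈ = ∈-++⁺ˡ (∈-map⁺ (g ,_) xs∈)
  ∈-translates⁺ {g ∷ gs} (there g∈) xs∈ =
    ∈-++⁺ʳ (List.map (g ,_) (compositions F (k ∸ height g))) (∈-translates⁺ g∈ xs∈)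

  ∈-translates⁻ : ∀ {gs g xs} → (g , xs) ∈ translates gs → g ∈ gs × xs ∈ compositions F (k ∸ height g)
  ∈-translates⁻ {g ∷ gs} p with ∈-++⁻ (List.map (g ,_) (compositions F (k ∸ height g))) p
  ... | inj₂ q = let g∈ , xs∈ = ∈-translates⁻ {gs} q in there g∈ , xs∈
  ... | inj₁ q with ∈-map⁻ (g ,_) q
  ...   | _ , xs∈ , refl = here refl , xs∈

  translates-unique : ∀ {gs} → Unique gs → Unique (translates gs)
  translates-unique [] = []
  translates-unique {g ∷ gs} (g∉gs ∷ u) = Unique.++⁺
    (Unique.map⁺ (cong proj₂) (compositions-unique F (k ∸ height g)))
    (translates-unique u)
    λ (p , q) → All.lookup g∉gs (proj₁ (∈-translates⁻ q)) (cong proj₁ (sym (proj₂ (proj₂ (∈-map⁻ (g ,_) p)))))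

  !*length-translates-∷ : ∀ {j} → ∣ F ∣ ≡ suc j → ∀ g gs →
    j ! ℕ.* length (translates (g ∷ gs)) ≡ rising j (k ∸ height g) ℕ.+ j ! ℕ.* length (translates gs)
  !*length-translates-∷ {j} ∣F∣≡ g gs = begin
    j ! ℕ.* length (translates (g ∷ gs))
      ≡⟨ cong (j ! ℕ.*_) (List.length-++ (List.map (g ,_) (compositions F K))) ⟩
    j ! ℕ.* (length (List.map (g ,_) (compositions F K)) ℕ.+ length (translates gs))
      ≡⟨ ℕ.*-distribˡ-+ (j !) _ _ ⟩
    j ! ℕ.* length (List.map (g ,_) (compositions F K)) ℕ.+ j ! ℕ.* length (translates gs)
      ≡⟨ cong (λ l → j ! ℕ.* l ℕ.+ j ! ℕ.* length (translates gs))
           (trans (List.length-map (g ,_) (compositions F K)) (trans (length-compositions F K) (cong (λ c → compositionCount c K) ∣F∣≡))) ⟩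
    j ! ℕ.* compositionCount (suc j) K ℕ.+ j ! ℕ.* length (translates gs)
      ≡⟨ cong (ℕ._+ j ! ℕ.* length (translates gs)) (!*compositionCount j K) ⟩
    rising j K ℕ.+ j ! ℕ.* length (translates gs) ∎
    where
    open ≡-Reasoning
    K = k ∸ height g

  length-translates-≤ : ∀ {j} → ∣ F ∣ ≡ suc j → ∀ gs →
    j ! ℕ.* length (translates gs) ℕ.≤ length gs ℕ.* (k ℕ.+ j) ℕ.^ j
  length-translates-≤ {j} ∣F∣≡ [] = ℕ.≤-reflexive (ℕ.*-zeroʳ (j !))
  length-translates-≤ {j} ∣F∣≡ (g ∷ gs) = subst (ℕ._≤ length (g ∷ gs) ℕ.* (k ℕ.+ j) ℕ.^ j) (sym (!*length-translates-∷ ∣F∣≡ g gs))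
    (ℕ.+-mono-≤
      (ℕ.≤-trans (rising≤^ j (k ∸ height g) j ℕ.≤-refl) (ℕ.^-monoˡ-≤ j (ℕ.+-monoˡ-≤ j (ℕ.m∸n≤m k (height g)))))
      (length-translates-≤ ∣F∣≡ gs))

  length-translates-≥ : ∀ {j} l → ∣ F ∣ ≡ suc j → ∀ {gs} → All (λ g → l ℕ.+ height g ℕ.≤ k) gs →
    length gs ℕ.* l ℕ.^ j ℕ.≤ j ! ℕ.* length (translates gs)
  length-translates-≥ {j} l ∣F∣≡ [] = ℕ.z≤n
  length-translates-≥ {j} l ∣F∣≡ {g ∷ gs} (p ∷ ps) = subst (length (g ∷ gs) ℕ.* l ℕ.^ j ℕ.≤_) (sym (!*length-translates-∷ ∣F∣≡ g gs))
    (ℕ.+-mono-≤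
      (ℕ.≤-trans (ℕ.^-monoˡ-≤ j (ℕ.m+n≤o⇒m≤o∸n l p)) (^≤rising j (k ∸ height g)))
      (length-translates-≥ l ∣F∣≡ ps))

-- Alternating sums over subsets

-- The sum of (-1)^(m - ∣ F ∣) f F over all F, that is, Möbius inversion on the Boolean lattice at
-- the full set, written as an iterated difference so that it can be evaluated one element at a
-- time.
alternatingSum : ∀ {m} → (Subset m → ℚ) → ℚ
alternatingSum {zero}  f = f []
alternatingSum {suc m} f = alternatingSum (f ∘ (inside ∷_)) - alternatingSum (f ∘ (outside ∷_))

alternatingSum-cong : ∀ {m} {f g : Subset m → ℚ} → f ≗ g → alternatingSum f ≡ alternatingSum g
alternatingSum-cong {zero}  f≗g = f≗g []
alternatingSum-cong {suc m} f≗g =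
  cong₂ _-_ (alternatingSum-cong (f≗g ∘ (inside ∷_))) (alternatingSum-cong (f≗g ∘ (outside ∷_)))

alternatingSum-0 : ∀ m → alternatingSum {m} (λ _ → 0ℚ) ≡ 0ℚ
alternatingSum-0 zero = refl
alternatingSum-0 (suc m) = ℚ.+-inverseʳ (alternatingSum {m} (λ _ → 0ℚ))

alternatingSum-+ : ∀ {m} (f g : Subset m → ℚ) →
  alternatingSum (λ F → f F + g F) ≡ alternatingSum f + alternatingSum g
alternatingSum-+ {zero} f g = refl
alternatingSum-+ {suc m} f g = trans
  (cong₂ _-_ (alternatingSum-+ (f ∘ (inside ∷_)) (g ∘ (inside ∷_)))
             (alternatingSum-+ (f ∘ (outside ∷_)) (g ∘ (outside ∷_))))
  (interchange (alternatingSum (f ∘ (inside ∷_))) (alternatingSum (g ∘ (inside ∷_)))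
               (alternatingSum (f ∘ (outside ∷_))) (alternatingSum (g ∘ (outside ∷_))))
  where
  interchange : ∀ a b c d → (a + b) - (c + d) ≡ (a - c) + (b - d)
  interchange = solve 4 (λ a b c d → (a :+ b) :- (c :+ d) := (a :- c) :+ (b :- d)) refl

-- The zeta function of the Boolean lattice, defined by recursion so that it reduces together with
-- `alternatingSum`.
χ : ∀ {m} → Subset m → Subset m → ℚ
χ []            []            = 1ℚ
χ (inside ∷ S)  (inside ∷ F)  = χ S F
χ (inside ∷ S)  (outside ∷ F) = 0ℚ
χ (outside ∷ S) (_ ∷ F)       = χ S F

χ-⊆ : ∀ {m} (S F : Subset m) → χ S F ≡ (if does (S ⊆? F) then 1ℚ else 0ℚ)
χ-⊆ []            []            = refl
χ-⊆ (inside ∷ S)  (inside ∷ F)  = χ-⊆ S F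
χ-⊆ (inside ∷ S)  (outside ∷ F) = refl
χ-⊆ (outside ∷ S) (_ ∷ F)       = χ-⊆ S F

-- For i outside S the terms of F and F ∪ {i} cancel, so the sum is 1 if S is the full set and 0
-- otherwise.
alternatingSum-χ : ∀ {m} (S : Subset m) → 0ℚ ≤ alternatingSum (χ S)
alternatingSum-χ [] = 0≤fromℕ 1
alternatingSum-χ {suc m} (inside ∷ S) =
  subst (0ℚ ≤_) (sym (trans (cong (_-_ (alternatingSum (χ S))) (alternatingSum-0 m)) (ℚ.+-identityʳ _))) (alternatingSum-χ S)
alternatingSum-χ (outside ∷ S) = ℚ.≤-reflexive (sym (ℚ.+-inverseʳ (alternatingSum (χ S))))

weightedχ : ∀ {m} → Subset m → Subset m → ℚ
weightedχ S F = fromℕ ∣ F ∣ * χ S F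

alternatingSum-weighted-inside : ∀ {m} (S : Subset m) →
  alternatingSum (λ F → fromℕ (suc ∣ F ∣) * χ S F) ≡ alternatingSum (χ S) + alternatingSum (weightedχ S)
alternatingSum-weighted-inside S = trans
  (alternatingSum-cong λ F → trans (cong (_* χ S F) (fromℕ-homo-+ 1 ∣ F ∣)) (distrib (fromℕ ∣ F ∣) (χ S F)))
  (alternatingSum-+ (χ S) (weightedχ S))
  where
  distrib : ∀ a b → (1ℚ + a) * b ≡ b + a * b
  distrib = solve 2 (λ a b → (con 1ℚ :+ a) :* b := b :+ a :* b) refl

-- For i outside S the weights of F and F ∪ {i} differ by 1, so pairing them leaves the unweighted
-- sum over the remaining elements. For i in S only the sets containing i count, and their extra 1
-- adds that same unweighted sum to the weighted one.
alternatingSum-weightedχ : ∀ {m} (S : Subset m) → 0ℚ ≤ alternatingSum (weightedχ S)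
alternatingSum-weightedχ [] = ℚ.≤-refl
alternatingSum-weightedχ {suc m} (inside ∷ S) = subst (0ℚ ≤_) (sym eq)
  (ℚ.+-mono-≤ (alternatingSum-χ S) (alternatingSum-weightedχ S))
  where
  open ≡-Reasoning
  eq : alternatingSum (weightedχ (inside ∷ S)) ≡ alternatingSum (χ S) + alternatingSum (weightedχ S)
  eq = begin
    alternatingSum (weightedχ (inside ∷ S))
      ≡⟨ cong₂ _-_ (alternatingSum-weighted-inside S)
           (trans (alternatingSum-cong {m} (λ F → ℚ.*-zeroʳ (fromℕ ∣ F ∣))) (alternatingSum-0 m)) ⟩
    (alternatingSum (χ S) + alternatingSum (weightedχ S)) - 0ℚ
      ≡⟨ ℚ.+-identityʳ _ ⟩
    alternatingSum (χ S) + alternatingSum (weightedχ S) ∎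
alternatingSum-weightedχ (outside ∷ S) = subst (0ℚ ≤_) (sym (trans
  (cong (_- alternatingSum (weightedχ S)) (alternatingSum-weighted-inside S))
  (ℚRing.//-rightDividesʳ (alternatingSum (weightedχ S)) (alternatingSum (χ S))))) (alternatingSum-χ S)

countBelow : ∀ {A : Set} {m} → (A → Subset m) → List A → Subset m → ℕ
countBelow support gs F = length (filter (λ g → support g ⊆? F) gs)

countBelow-∷ : ∀ {A : Set} {m} (support : A → Subset m) g gs F →
  fromℕ (countBelow support (g ∷ gs) F) ≡ χ (support g) F + fromℕ (countBelow support gs F)
countBelow-∷ support g gs F with does (support g ⊆? F) | χ-⊆ (support g) F
... | true  | e = trans (fromℕ-homo-+ 1 (countBelow support gs F)) (cong (_+ fromℕ (countBelow support gs F)) (sym e))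
... | false | e = trans (sym (ℚ.+-identityˡ _)) (cong (_+ fromℕ (countBelow support gs F)) (sym e))

alternatingSum-countBelow : ∀ {A : Set} {m} (support : A → Subset m) gs →
  0ℚ ≤ alternatingSum (λ F → fromℕ ∣ F ∣ * fromℕ (countBelow support gs F))
alternatingSum-countBelow {m = m} support [] = ℚ.≤-reflexive (sym (trans
  (alternatingSum-cong {m} (λ F → ℚ.*-zeroʳ (fromℕ ∣ F ∣))) (alternatingSum-0 m)))
alternatingSum-countBelow support (g ∷ gs) = subst (0ℚ ≤_) (sym (trans
  (alternatingSum-cong λ F → trans (cong (fromℕ ∣ F ∣ *_) (countBelow-∷ support g gs F)) (ℚ.*-distribˡ-+ (fromℕ ∣ F ∣) _ _))
  (alternatingSum-+ (weightedχ (support g)) _)))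
  (ℚ.+-mono-≤ (alternatingSum-weightedχ (support g)) (alternatingSum-countBelow support gs))

-- From the sum over dimensions to the alternating sum over subsets

sign : ℕ → ℚ
sign k = fromℤ (-1ℤ ℤ.^ k)

sign-suc : ∀ k → sign (suc k) ≡ - sign k
sign-suc k = trans (cong fromℤ (ℤ.-1*i≡-i (-1ℤ ℤ.^ k))) (fromℤ-homo-neg (-1ℤ ℤ.^ k))

listSum : ∀ {A : Set} → (A → ℚ) → List A → ℚ
listSum f xs = List.foldr _+_ 0ℚ (List.map f xs)

listSum-cong : ∀ {A : Set} {f g : A → ℚ} → f ≗ g → ∀ xs → listSum f xs ≡ listSum g xs
listSum-cong f≗g xs = cong (List.foldr _+_ 0ℚ) (List.map-cong f≗g xs)

listSum-map : ∀ {A B : Set} (f : B → ℚ) (h : A → B) xs → listSum f (List.map h xs) ≡ listSum (f ∘ h) xs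
listSum-map f h xs = cong (List.foldr _+_ 0ℚ) (sym (List.map-∘ xs))

listSum-++ : ∀ {A : Set} (f : A → ℚ) xs ys → listSum f (xs ++ ys) ≡ listSum f xs + listSum f ys
listSum-++ f [] ys = sym (ℚ.+-identityˡ _)
listSum-++ f (x ∷ xs) ys = trans (cong (_+_ (f x)) (listSum-++ f xs ys)) (sym (ℚ.+-assoc (f x) _ _))

listSum-neg : ∀ {A : Set} (f : A → ℚ) xs → listSum (λ x → - f x) xs ≡ - listSum f xs
listSum-neg f [] = refl
listSum-neg f (x ∷ xs) = trans (cong (_+_ (- f x)) (listSum-neg f xs)) (sym (ℚ.neg-distrib-+ (f x) _))

alternatingSum-as-listSum : ∀ m (f : Subset m → ℚ) →
  listSum (λ F → sign (m ∸ ∣ F ∣) * f F) (subsets m) ≡ alternatingSum f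
alternatingSum-as-listSum zero f = trans (ℚ.+-identityʳ _) (ℚ.*-identityˡ (f []))
alternatingSum-as-listSum (suc m) f = begin
  listSum t (List.map (outside ∷_) (subsets m) ++ List.map (inside ∷_) (subsets m))
    ≡⟨ listSum-++ t (List.map (outside ∷_) (subsets m)) _ ⟩
  listSum t (List.map (outside ∷_) (subsets m)) + listSum t (List.map (inside ∷_) (subsets m))
    ≡⟨ cong₂ _+_ (listSum-map t (outside ∷_) (subsets m)) (listSum-map t (inside ∷_) (subsets m)) ⟩
  listSum (t ∘ (outside ∷_)) (subsets m) + listSum (t ∘ (inside ∷_)) (subsets m)
    ≡⟨ cong (_+ listSum (t ∘ (inside ∷_)) (subsets m)) (trans (listSum-cong negated (subsets m)) (listSum-neg _ (subsets m))) ⟩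
  - listSum (λ F → sign (m ∸ ∣ F ∣) * f (outside ∷ F)) (subsets m) + listSum (t ∘ (inside ∷_)) (subsets m)
    ≡⟨ cong₂ (λ x y → - x + y) (alternatingSum-as-listSum m (f ∘ (outside ∷_))) (alternatingSum-as-listSum m (f ∘ (inside ∷_))) ⟩
  - alternatingSum (f ∘ (outside ∷_)) + alternatingSum (f ∘ (inside ∷_))
    ≡⟨ ℚ.+-comm (- alternatingSum (f ∘ (outside ∷_))) (alternatingSum (f ∘ (inside ∷_))) ⟩
  alternatingSum f ∎
  where
  open ≡-Reasoning
  t : Subset (suc m) → ℚ
  t F = sign (suc m ∸ ∣ F ∣) * f F
  negated : ∀ F → t (outside ∷ F) ≡ - (sign (m ∸ ∣ F ∣) * f (outside ∷ F))
  negated F = begin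
    sign (suc m ∸ ∣ F ∣) * f (outside ∷ F)     ≡⟨ cong (λ k → sign k * f (outside ∷ F)) (ℕ.+-∸-assoc 1 (∣p∣≤n F)) ⟩
    sign (suc (m ∸ ∣ F ∣)) * f (outside ∷ F)   ≡⟨ cong (_* f (outside ∷ F)) (sign-suc (m ∸ ∣ F ∣)) ⟩
    - sign (m ∸ ∣ F ∣) * f (outside ∷ F)       ≡⟨ ℚ.neg-distribˡ-* (sign (m ∸ ∣ F ∣)) _ ⟨
    - (sign (m ∸ ∣ F ∣) * f (outside ∷ F))     ∎

-- A face with t vertices has dimension t - 1. The empty subset has no place in c and gets the value
-- 0.
atPredecessor : (ℕ → ℚ) → ℕ → ℚ → ℚ
atPredecessor A zero    v = 0ℚ
atPredecessor A (suc t) v = A t * v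

sum-select : ∀ m (A : ℕ → ℚ) t v → t ℕ.≤ m →
  sum {m} (λ j → A (toℕ j) * (if t ≡ᵇ suc (toℕ j) then v else 0ℚ)) ≡ atPredecessor A t v
sum-select m A zero v _ = trans (sum-cong-≗ {m} (λ j → ℚ.*-zeroʳ (A (toℕ j)))) (sum-replicate-zero m)
sum-select (suc m) A (suc zero) v _ =
  trans (cong (_+_ (A 0 * v)) (sum-select m (A ∘ suc) zero v ℕ.z≤n)) (ℚ.+-identityʳ _)
sum-select (suc m) A (suc (suc t)) v (ℕ.s≤s t<m) =
  trans (cong₂ _+_ (ℚ.*-zeroʳ (A 0)) (sum-select m (A ∘ suc) (suc t) v t<m)) (ℚ.+-identityˡ _)

listSum-filter-∷ : ∀ {m} (vol : Subset m → ℚ) j F Fs →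
  listSum vol (filter (λ F → ∣ F ∣ ℕ.≟ suc j) (F ∷ Fs)) ≡
  (if ∣ F ∣ ≡ᵇ suc j then vol F else 0ℚ) + listSum vol (filter (λ F → ∣ F ∣ ℕ.≟ suc j) Fs)
-- The decision inside `filter` computes to this boolean, so abstracting it reduces both sides.
listSum-filter-∷ vol j F Fs with ∣ F ∣ ≡ᵇ suc j
... | true  = refl
... | false = sym (ℚ.+-identityˡ _)

sum-by-cardinality : ∀ {m} (A : ℕ → ℚ) (vol : Subset m → ℚ) Fs →
  sum {m} (λ j → A (toℕ j) * listSum vol (filter (λ F → ∣ F ∣ ℕ.≟ suc (toℕ j)) Fs)) ≡
  listSum (λ F → atPredecessor A ∣ F ∣ (vol F)) Fs
sum-by-cardinality {m} A vol [] = trans (sum-cong-≗ {m} (λ j → ℚ.*-zeroʳ (A (toℕ j)))) (sum-replicate-zero m)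
sum-by-cardinality {m} A vol (F ∷ Fs) = begin
  sum {m} (λ j → A (toℕ j) * part (F ∷ Fs) (toℕ j))
    ≡⟨ sum-cong-≗ {m} (λ j → trans (cong (A (toℕ j) *_) (listSum-filter-∷ vol (toℕ j) F Fs)) (ℚ.*-distribˡ-+ (A (toℕ j)) _ _)) ⟩
  sum {m} (λ j → A (toℕ j) * δ (toℕ j) + A (toℕ j) * part Fs (toℕ j))
    ≡⟨ ∑-distrib-+ {m} (λ j → A (toℕ j) * δ (toℕ j)) _ ⟩
  sum {m} (λ j → A (toℕ j) * δ (toℕ j)) + sum {m} (λ j → A (toℕ j) * part Fs (toℕ j))
    ≡⟨ cong₂ _+_ (sum-select m A ∣ F ∣ (vol F) (∣p∣≤n F)) (sum-by-cardinality A vol Fs) ⟩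
  listSum (λ F → atPredecessor A ∣ F ∣ (vol F)) (F ∷ Fs) ∎
  where
  open ≡-Reasoning
  part : List (Subset m) → ℕ → ℚ
  part Fs j = listSum vol (filter (λ F → ∣ F ∣ ℕ.≟ suc j) Fs)
  δ : ℕ → ℚ
  δ j = if ∣ F ∣ ≡ᵇ suc j then vol F else 0ℚ

c-as-alternatingSum : ∀ n vol → c n vol ≡ alternatingSum (λ F → fromℕ ∣ F ∣ * vol F)
c-as-alternatingSum n vol = trans
  (sum-by-cardinality A vol (subsets (suc n)))
  (trans (listSum-cong term (subsets (suc n))) (alternatingSum-as-listSum (suc n) (λ F → fromℕ ∣ F ∣ * vol F)))
  where
  A : ℕ → ℚ
  A j = sign (n ∸ j) * fromℕ (suc j)
  term : ∀ F → atPredecessor A ∣ F ∣ (vol F) ≡ sign (suc n ∸ ∣ F ∣) * (fromℕ ∣ F ∣ * vol F)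
  term F with ∣ F ∣
  -- On the right the empty subset disappears because its weight ∣ F ∣ is 0, whatever `vol` assigns
  -- to it.
  ... | zero  = sym (trans (cong (sign (suc n) *_) (ℚ.*-zeroˡ (vol F))) (ℚ.*-zeroʳ (sign (suc n))))
  ... | suc t = ℚ.*-assoc (sign (n ∸ t)) (fromℕ (suc t)) (vol F)

-- Lattice points in the cone over the simplex

vec-ext : ∀ {A : Set} {m} {xs ys : Vec A m} → (∀ i → lookup xs i ≡ lookup ys i) → xs ≡ ys
vec-ext {xs = xs} {ys} p = trans (sym (Vec.tabulate∘lookup xs)) (trans (Vec.tabulate-cong p) (Vec.tabulate∘lookup ys))

sum-- : ∀ {m} (f g : Fin m → ℚ) → sum (λ i → f i - g i) ≡ sum f - sum g
sum-- f g = trans (∑-distrib-+ f (λ i → - g i)) (cong (_+_ (sum f)) (trans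
  (sum-cong-≗ (λ i → sym (ℚRing.-1*x≈-x (g i)))) (trans (sum-* (- 1ℚ) g) (ℚRing.-1*x≈-x (sum g)))))

combination-- : ∀ {m n} (μ ν : Fin m → ℚ) (v : Fin m → LatticePoint n) a →
  combination (λ i → μ i - ν i) v a ≡ combination μ v a - combination ν v a
combination-- μ ν v a = trans (combination-+ μ (λ i → - ν i) v a) (cong (_+_ (combination μ v a)) (trans
  (combination-cong v a (λ i → sym (ℚRing.-1*x≈-x (ν i)))) (trans (combination-* (- 1ℚ) ν v a) (ℚRing.-1*x≈-x _))))

sum-fromℕ : ∀ {m} (xs : Vec ℕ m) → sum (λ i → fromℕ (lookup xs i)) ≡ fromℕ (Vec.sum xs)
sum-fromℕ [] = refl
sum-fromℕ (x ∷ xs) = trans (cong (_+_ (fromℕ x)) (sum-fromℕ xs)) (sym (fromℕ-homo-+ x (Vec.sum xs)))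

VanishesOffℚ : ∀ {m} → Subset m → (Fin m → ℚ) → Set
VanishesOffℚ F μ = ∀ i → i ∉ F → μ i ≡ 0ℚ

supportℚ : ∀ {m} → Vec ℚ m → Subset m
supportℚ = Vec.map λ q → not (does (q ℚ.≟ 0ℚ))

vanishes⇒support⊆ : ∀ {m} (xs : Vec ℚ m) {F} → VanishesOffℚ F (lookup xs) → supportℚ xs ⊆ F
vanishes⇒support⊆ xs {F} v {i} i∈ with i ∈? F
... | yes i∈F = i∈F
... | no i∉F with lookup xs i ℚ.≟ 0ℚ | trans (sym (Vec.lookup-map i _ xs)) (Vec.[]=⇒lookup i∈)
...   | yes _ | ()
...   | no x≢0 | _ = contradiction (v i i∉F) x≢0

support⊆⇒vanishes : ∀ {m} (xs : Vec ℚ m) {F} → supportℚ xs ⊆ F → VanishesOffℚ F (lookup xs)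
support⊆⇒vanishes xs {F} S⊆F i i∉F with lookup xs i ℚ.≟ 0ℚ in eq
... | yes x≡0 = x≡0
... | no x≢0 = contradiction (S⊆F (Vec.lookup⇒[]= i _
        (trans (Vec.lookup-map i _ xs) (cong (not ∘ does) eq)))) i∉F

module _ {n : ℕ} (P : LatticeSimplex n) where

  private v = vertex P

  -- Coordinates (with respect to the vertices placed at height 1) of the
  -- lattice points at height k in the cone over P.
  record ConePoint (k : ℕ) (μ : Fin (suc n) → ℚ) : Set where
    constructor conePoint
    field
      nonNeg   : ∀ i → 0ℚ ≤ μ i
      sum≡     : sum μ ≡ fromℕ k
      integral : ∀ a → Integral (combination μ v a)

  -- The height is the coordinate sum of ω, carried along as a natural number so that `k ∸ h` can be
  -- formed.
  record BoxPoint (g : Vec ℚ (suc n) × ℕ) : Set where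
    constructor boxPoint
    field
      inCone : ConePoint (proj₂ g) (lookup (proj₁ g))
      <1     : ∀ i → lookup (proj₁ g) i < 1ℚ

  support : Vec ℚ (suc n) × ℕ → Subset (suc n)
  support (ω , _) = supportℚ ω

  height≤ : ∀ {g} → BoxPoint g → proj₂ g ℕ.≤ suc n
  height≤ {ω , h} (boxPoint (conePoint _ sum≡ _) <1) = fromℕ-cancel-≤ (subst₂ _≤_ sum≡ (sum-1 (suc n)) (sum-mono-≤ (λ i → ℚ.<⇒≤ (<1 i))))

  translate : (Vec ℚ (suc n) × ℕ) × Vec ℕ (suc n) → Fin (suc n) → ℚ
  translate ((ω , _) , xs) i = lookup ω i + fromℕ (lookup xs i)

  translate-cone : ∀ {F k g xs} → BoxPoint g → support g ⊆ F → proj₂ g ℕ.≤ k → xs ∈ compositions F (k ∸ proj₂ g) →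
    ConePoint k (translate (g , xs)) × VanishesOffℚ F (translate (g , xs))
  translate-cone {F} {k} {ω , h} {xs} (boxPoint (conePoint 0≤ω sum-ω int) _) S⊆F h≤k xs∈ =
    conePoint
      (λ i → ℚ.+-mono-≤ (0≤ω i) (0≤fromℕ (lookup xs i)))
      (begin
        sum (λ i → lookup ω i + fromℕ (lookup xs i))       ≡⟨ ∑-distrib-+ (lookup ω) (λ i → fromℕ (lookup xs i)) ⟩
        sum (lookup ω) + sum (λ i → fromℕ (lookup xs i))   ≡⟨ cong₂ _+_ sum-ω (trans (sum-fromℕ xs) (cong fromℕ sum-xs)) ⟩
        fromℕ h + fromℕ (k ∸ h)                            ≡⟨ fromℕ-homo-+ h (k ∸ h) ⟨
        fromℕ (h ℕ.+ (k ∸ h))                              ≡⟨ cong fromℕ (ℕ.m+[n∸m]≡n h≤k) ⟩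
        fromℕ k                                            ∎)
      (λ a → subst Integral (sym (combination-+ (lookup ω) (λ i → fromℕ (lookup xs i)) v a))
        (integral-+ (int a) (integral-combination (λ i → fromℕ (lookup xs i)) v a (λ i → + lookup xs i , refl))))
    , λ i i∉F → cong₂ _+_ (support⊆⇒vanishes ω S⊆F i i∉F) (cong fromℕ (off-xs i i∉F))
    where
    open ≡-Reasoning
    sum-xs = proj₁ (All.lookup (compositions-sound F (k ∸ h)) xs∈)
    off-xs = proj₂ (All.lookup (compositions-sound F (k ∸ h)) xs∈)

  -- Fractional parts of the coordinates form ω and integer parts form `xs`. Removing integer
  -- multiples of the vertices preserves integrality of the point.
  decompose : ∀ {F k μ} → ConePoint k μ → VanishesOffℚ F μ →
    ∃[ g ] ∃[ xs ] BoxPoint g × support g ⊆ F × xs ∈ compositions F (k ∸ proj₂ g) × (∀ i → translate (g , xs) i ≡ μ i)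
  decompose {F} {k} {μ} (conePoint 0≤μ sum-μ int) off =
    (ω , h) , xs ,
    boxPoint
      (conePoint
        (λ i → subst (0ℚ ≤_) (sym (ω-def i)) (proj₁ (proj₂ (fl i))))
        sum-ω-h
        λ a → subst Integral (sym (trans (combination-cong v a ω-def) (combination-- μ (λ i → fromℕ (x i)) v a)))
          (integral-+ (int a) (integral-neg (integral-combination (λ i → fromℕ (x i)) v a (λ i → + x i , refl)))))
      (λ i → subst (_< 1ℚ) (sym (ω-def i)) (proj₂ (proj₂ (fl i)))) ,
    vanishes⇒support⊆ ω (λ i i∉F → trans (ω-def i) (cong₂ (λ p q → p - fromℕ q) (off i i∉F) (x≡0 i i∉F))) ,
    compositions-complete F (k ∸ h) xs
      (trans (sym (ℕ.m+n∸m≡n h (Vec.sum xs))) (cong (_∸ h) h+sum≡k))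
      (λ i i∉F → trans (Vec.lookup∘tabulate x i) (x≡0 i i∉F)) ,
    λ i → trans (cong₂ _+_ (ω-def i) (cong fromℕ (Vec.lookup∘tabulate x i))) (ℚRing.//-rightDividesˡ (fromℕ (x i)) (μ i))
    where
    fl : ∀ i → ∃[ m ] (0ℚ ≤ μ i - fromℕ m × μ i - fromℕ m < 1ℚ)
    fl i = floor (μ i) (0≤μ i)
    x : Fin (suc n) → ℕ
    x i = proj₁ (fl i)
    ω = tabulate (λ i → μ i - fromℕ (x i))
    xs = tabulate x
    ω-def : ∀ i → lookup ω i ≡ μ i - fromℕ (x i)
    ω-def = Vec.lookup∘tabulate (λ i → μ i - fromℕ (x i))
    sum-x : sum (λ i → fromℕ (x i)) ≡ fromℕ (Vec.sum xs)
    sum-x = trans (sum-cong-≗ (λ i → cong fromℕ (sym (Vec.lookup∘tabulate x i)))) (sum-fromℕ xs)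
    sum-ω : sum (lookup ω) ≡ fromℕ k - fromℕ (Vec.sum xs)
    sum-ω = trans (sum-cong-≗ ω-def) (trans (sum-- μ (λ i → fromℕ (x i))) (cong₂ _-_ sum-μ sum-x))
    sum-0≤ : ∀ {m} {f : Fin m → ℚ} → (∀ i → 0ℚ ≤ f i) → 0ℚ ≤ sum f
    sum-0≤ {zero} p = ℚ.≤-refl
    sum-0≤ {suc m} p = ℚ.+-mono-≤ (p zero) (sum-0≤ (p ∘ suc))
    -- The sum of ω is k minus the integer parts, hence an integer, and it is nonnegative.
    heightOf : ∃[ h ] sum (lookup ω) ≡ fromℕ h
    heightOf = integral-nonNeg
      (subst Integral (sym sum-ω) (integral-+ (+ k , refl) (integral-neg (+ Vec.sum xs , refl))))
      (sum-0≤ (λ i → subst (0ℚ ≤_) (sym (ω-def i)) (proj₁ (proj₂ (fl i)))))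
    h = proj₁ heightOf
    sum-ω-h = proj₂ heightOf
    h+sum≡k : h ℕ.+ Vec.sum xs ≡ k
    h+sum≡k = fromℕ-injective (begin
      fromℕ (h ℕ.+ Vec.sum xs)                           ≡⟨ fromℕ-homo-+ h (Vec.sum xs) ⟩
      fromℕ h + fromℕ (Vec.sum xs)                       ≡⟨ cong (_+ fromℕ (Vec.sum xs)) (trans (sym sum-ω-h) sum-ω) ⟩
      (fromℕ k - fromℕ (Vec.sum xs)) + fromℕ (Vec.sum xs) ≡⟨ ℚRing.//-rightDividesˡ (fromℕ (Vec.sum xs)) (fromℕ k) ⟩
      fromℕ k                                            ∎)
      where open ≡-Reasoning
    -- From 0 ≤ μ i - x i and μ i = 0 off F.
    x≡0 : ∀ i → i ∉ F → x i ≡ 0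
    x≡0 i i∉F = ℕ.n≤0⇒n≡0 (fromℕ-cancel-≤ (subst₂ _≤_ (ℚ.+-identityˡ _)
      (trans (ℚRing.//-rightDividesˡ (fromℕ (x i)) (μ i)) (off i i∉F)) (ℚ.+-monoˡ-≤ (fromℕ (x i)) (proj₁ (proj₂ (fl i))))))

  translate-injective : ∀ {g g′ xs xs′} → BoxPoint g → BoxPoint g′ →
    (∀ i → translate (g , xs) i ≡ translate (g′ , xs′) i) → (g , xs) ≡ (g′ , xs′)
  translate-injective {ω , h} {ω′ , h′} {xs} {xs′} (boxPoint (conePoint 0≤ω sum-ω _) ω<1) (boxPoint (conePoint 0≤ω′ sum-ω′ _) ω′<1) e =
    cong₂ _,_ (cong₂ _,_ ω≡ (fromℕ-injective (trans (sym sum-ω) (trans (cong (λ ω → sum (lookup ω)) ω≡) sum-ω′)))) (vec-ext xs≡)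
    where
    xs≡ : ∀ i → lookup xs i ≡ lookup xs′ i
    xs≡ i = ℕ.≤-antisym
      (floor-unique (lookup xs′ i) (lookup xs i) (ω′<1 i) (0≤ω i) (sym (e i)))
      (floor-unique (lookup xs i) (lookup xs′ i) (ω<1 i) (0≤ω′ i) (e i))
    ω≡ : ω ≡ ω′
    ω≡ = vec-ext (λ i → ℚRing.+-cancelʳ (fromℕ (lookup xs i)) (lookup ω i) (lookup ω′ i) (trans (e i) (cong (λ x → lookup ω′ i + fromℕ x) (sym (xs≡ i)))))

  -- Frame coordinates and tiles

  module _ {F : Subset (suc n)} {j : ℕ} (L : LatticeFrame P F j) where

    open LatticeFrame L

    -- The point of the cone at height k with coordinates μ is the lattice point
    -- of k aff(F) with frame coordinates z.
    record Represents (k : ℕ) (μ : Fin (suc n) → ℚ) (z : Vec ℤ j) : Set where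
      constructor represents
      field
        same-point : ∀ a → combination μ v a ≡ fromℕ k * fromℤ (origin a) + combination (λ i → fromℤ (lookup z i)) basis a

    -- Affine independence speaks of coefficients with sum 0; equal heights make the difference of μ
    -- and ν of this kind.
    represents-injectiveˡ : ∀ {k μ ν z} → sum μ ≡ sum ν → Represents k μ z → Represents k ν z → ∀ i → μ i ≡ ν i
    represents-injectiveˡ {μ = μ} {ν} sum≡ (represents r) (represents r′) i = ℚRing.x∙y⁻¹≈ε⇒x≈y (μ i) (ν i) (independent P (λ i → μ i - ν i)
      (trans (sum-- μ ν) (ℚRing.x≈y⇒x∙y⁻¹≈ε sum≡))
      (λ a → trans (combination-- μ ν v a) (ℚRing.x≈y⇒x∙y⁻¹≈ε (trans (r a) (sym (r′ a))))) i)

    represents-injectiveʳ : ∀ {k μ z z′} → Represents k μ z → Represents k μ z′ → z ≡ z′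
    represents-injectiveʳ {k} {μ} {z} {z′} (represents r) (represents r′) = vec-ext λ i → ℤ.i-j≡0⇒i≡j (lookup z i) (lookup z′ i)
      (basis-independent (λ i → lookup z i ℤ.- lookup z′ i) (λ a → begin
        combination (λ i → fromℤ (lookup z i ℤ.- lookup z′ i)) basis a
          ≡⟨ combination-cong basis a (λ i → trans (fromℤ-homo-+ (lookup z i) (ℤ.- lookup z′ i)) (cong (_+_ (fromℤ (lookup z i))) (fromℤ-homo-neg (lookup z′ i)))) ⟩
        combination (λ i → fromℤ (lookup z i) - fromℤ (lookup z′ i)) basis a
          ≡⟨ combination-- (λ i → fromℤ (lookup z i)) (λ i → fromℤ (lookup z′ i)) basis a ⟩
        combination (λ i → fromℤ (lookup z i)) basis a - combination (λ i → fromℤ (lookup z′ i)) basis a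
          ≡⟨ ℚRing.x≈y⇒x∙y⁻¹≈ε (ℚRing.+-cancelˡ (fromℕ k * fromℤ (origin a)) _ _ (trans (sym (r a)) (r′ a))) ⟩
        0ℚ ∎) i)
      where open ≡-Reasoning

    originInAff : InAff P F (toPoint origin)
    originInAff = Equivalence.from (spans origin) ((λ _ → 0ℤ) , λ a → sym (trans
      (cong (_+_ (fromℤ (origin a))) (trans
        -- Writing 0 as 0 * 0 lets `combination-*` pull a factor 0 out of the zero combination.
        (combination-cong {μ = λ _ → 0ℚ} {ν = λ _ → 0ℚ * 0ℚ} basis a (λ _ → refl))
        (trans (combination-* 0ℚ (λ _ → 0ℚ) basis a) (ℚ.*-zeroˡ (combination (λ _ → 0ℚ) basis a)))))
      (ℚ.+-identityʳ (fromℤ (origin a)))))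

    module _ (k′ : ℕ) where

      private
        k = suc k′
        κ = fromℕ k
        instance
          κ>0 = positive (fromℕ-mono-< {0} {k} ℕ.z<s)
          κ≠0 = ℚ.pos⇒nonZero κ
        κ⁻¹ = 1/ κ
        0≤κ⁻¹ : 0ℚ ≤ κ⁻¹
        0≤κ⁻¹ = ℚ.<⇒≤ (ℚ.positive⁻¹ κ⁻¹ {{ℚ.1/pos⇒pos κ}})
        0≤* : ∀ {p q} → 0ℚ ≤ p → 0ℚ ≤ q → 0ℚ ≤ p * q
        0≤* {p} {q} 0≤p 0≤q = subst (_≤ p * q) (ℚ.*-zeroʳ p) (ℚ.*-monoˡ-≤-nonNeg p {{nonNegative 0≤p}} 0≤q)
        κκ⁻¹ : ∀ p → κ * (κ⁻¹ * p) ≡ p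
        κκ⁻¹ p = trans (sym (ℚ.*-assoc κ κ⁻¹ p)) (trans (cong (_* p) (ℚ.*-inverseʳ κ)) (ℚ.*-identityˡ p))
        κ⁻¹κ : ∀ p → κ⁻¹ * (κ * p) ≡ p
        κ⁻¹κ p = trans (sym (ℚ.*-assoc κ⁻¹ κ p)) (trans (cong (_* p) (ℚ.*-inverseˡ κ)) (ℚ.*-identityˡ p))

        -- The lower corner z/k of the tile at z; it belongs to the tile because the lower
        -- inequalities of `InTile` are not strict.
        corner : Vec ℤ j → Fin j → ℚ
        corner z i = κ⁻¹ * fromℤ (lookup z i)

        corner-inTile : ∀ z → InTile k z (corner z)
        corner-inTile z i = ℚ.≤-reflexive (sym (κκ⁻¹ (fromℤ (lookup z i)))) ,
          subst (_< fromℤ (lookup z i) + 1ℚ) (trans (ℚ.+-identityʳ _) (sym (κκ⁻¹ (fromℤ (lookup z i)))))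
            (ℚ.+-monoʳ-< (fromℤ (lookup z i)) (fromℕ-mono-< {0} {1} ℕ.z<s))

        κ*corner : ∀ z a → κ * point (corner z) a ≡ κ * fromℤ (origin a) + combination (λ i → fromℤ (lookup z i)) basis a
        κ*corner z a = trans (ℚ.*-distribˡ-+ κ (fromℤ (origin a)) _) (cong (_+_ (κ * fromℤ (origin a)))
          (trans (cong (κ *_) (combination-* κ⁻¹ (λ i → fromℤ (lookup z i)) basis a)) (κκ⁻¹ _)))

      tile⇒conePoint : ∀ z → TileInside k z → ∃[ μ ] ConePoint k μ × VanishesOffℚ F μ × Represents k μ z
      tile⇒conePoint z inFace =
        let ν , 0≤ν , off , sum≡1 , point≡ = inFace (corner z) (corner-inTile z)
            μ≡z = λ a → trans (combination-* κ ν v a) (trans (cong (κ *_) (sym (point≡ a))) (κ*corner z a))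
        in (λ i → κ * ν i)
         , conePoint
             (λ i → 0≤* (0≤fromℕ k) (0≤ν i))
             (trans (sum-* κ ν) (trans (cong (κ *_) sum≡1) (ℚ.*-identityʳ κ)))
             (λ a → subst Integral (sym (μ≡z a)) (integral-+
               (integral-* (+ k , refl) (origin a , refl))
               (integral-combination (λ i → fromℤ (lookup z i)) basis a (λ i → lookup z i , refl))))
         , (λ i i∉F → trans (cong (κ *_) (off i i∉F)) (ℚ.*-zeroʳ κ))
         , represents μ≡z

      -- `spans` gives integer coordinates only for lattice points of aff(F), at height 1. The point
      -- x at height k = k′ + 1 is brought there by subtracting k′ copies of the origin; adding them
      -- back does not change the coordinates z.
      conePoint⇒tile : ∀ {μ} → ConePoint k μ → VanishesOffℚ F μ → ∃[ z ] TileMeets k z × Represents k μ z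
      conePoint⇒tile {μ} (conePoint 0≤μ sum-μ int) off = z , meets , represents μ≡z
        where
        open ≡-Reasoning
        κ′ = fromℕ k′
        o = proj₁ originInAff
        o-off = proj₁ (proj₂ originInAff)
        o-sum = proj₁ (proj₂ (proj₂ originInAff))
        o-eq = proj₂ (proj₂ (proj₂ originInAff))
        x : LatticePoint n
        x a = proj₁ (int a)
        y : LatticePoint n
        y a = x a ℤ.- + k′ ℤ.* origin a
        y-eq : ∀ a → toPoint y a ≡ combination μ v a - κ′ * fromℤ (origin a)
        y-eq a = begin
          fromℤ (x a ℤ.- + k′ ℤ.* origin a)             ≡⟨ fromℤ-homo-+ (x a) (ℤ.- (+ k′ ℤ.* origin a)) ⟩
          fromℤ (x a) + fromℤ (ℤ.- (+ k′ ℤ.* origin a)) ≡⟨ cong₂ _+_ (sym (proj₂ (int a))) (trans (fromℤ-homo-neg (+ k′ ℤ.* origin a)) (cong -_ (fromℤ-homo-* (+ k′) (origin a)))) ⟩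
          combination μ v a - κ′ * fromℤ (origin a)     ∎
        ν : Fin (suc n) → ℚ
        ν i = μ i - κ′ * o i
        shrink : ∀ p → (1ℚ + p) - p * 1ℚ ≡ 1ℚ
        shrink = solve 1 (λ p → (con 1ℚ :+ p) :- p :* con 1ℚ := con 1ℚ) refl
        yInAff : InAff P F (toPoint y)
        yInAff = ν
          , (λ i i∉F → trans (cong₂ (λ p q → p - κ′ * q) (off i i∉F) (o-off i i∉F)) (cong (λ t → 0ℚ - t) (ℚ.*-zeroʳ κ′)))
          , trans (sum-- μ (λ i → κ′ * o i)) (trans
              (cong₂ _-_ (trans sum-μ (fromℕ-homo-+ 1 k′)) (trans (sum-* κ′ o) (cong (κ′ *_) o-sum))) (shrink κ′))
          , λ a → trans (y-eq a) (sym (trans (combination-- μ (λ i → κ′ * o i) v a)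
              (cong (_-_ (combination μ v a)) (trans (combination-* κ′ o v a) (cong (κ′ *_) (sym (o-eq a)))))))
        coords = Equivalence.to (spans y) yInAff
        z = tabulate (proj₁ coords)
        regroup : ∀ c o k s → c - k * o ≡ o + s → c ≡ (1ℚ + k) * o + s
        regroup c o k s e = trans (sym (ℚRing.//-rightDividesˡ (k * o) c)) (trans (cong (_+ k * o) e) (rhs o k s))
          where
          rhs : ∀ o k s → (o + s) + k * o ≡ (1ℚ + k) * o + s
          rhs = solve 3 (λ o k s → (o :+ s) :+ k :* o := (con 1ℚ :+ k) :* o :+ s) refl
        μ≡z : ∀ a → combination μ v a ≡ κ * fromℤ (origin a) + combination (λ i → fromℤ (lookup z i)) basis a
        μ≡z a = trans
          (regroup (combination μ v a) (fromℤ (origin a)) κ′ _ (trans (sym (y-eq a)) (proj₂ coords a)))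
          (cong₂ _+_ (cong (_* fromℤ (origin a)) (sym (fromℕ-homo-+ 1 k′)))
            (combination-cong basis a (λ i → cong fromℤ (sym (Vec.lookup∘tabulate (proj₁ coords) i)))))
        meets : TileMeets k z
        meets = corner z , corner-inTile z , (λ i → κ⁻¹ * μ i)
          , (λ i → 0≤* 0≤κ⁻¹ (0≤μ i))
          , (λ i i∉F → trans (cong (κ⁻¹ *_) (off i i∉F)) (ℚ.*-zeroʳ κ⁻¹))
          , trans (sum-* κ⁻¹ μ) (trans (cong (κ⁻¹ *_) sum-μ) (ℚ.*-inverseˡ κ))
          , λ a → trans (sym (κ⁻¹κ (point (corner z) a)))
              (trans (cong (κ⁻¹ *_) (trans (κ*corner z a) (sym (μ≡z a)))) (sym (combination-* κ⁻¹ μ v a)))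

-- Normalized volumes count box points

-- Shifting k by a constant does not affect the coefficient of kʲ, so `leading-≤` gives V - ε ≤ N ≤
-- V + ε for every ε > 0.
asymptotically-equal : ∀ {V} N j a →
  (∀ ε → 0ℚ < ε → ∃[ K ] (∀ k → K ℕ.≤ k → ∃[ p ] (V - ε) * fromℕ (k ℕ.^ j) ≤ fromℕ p × p ℕ.≤ N ℕ.* (k ℕ.+ j) ℕ.^ j)) →
  (∀ ε → 0ℚ < ε → ∃[ K ] (∀ k → K ℕ.≤ k → ∃[ p ] N ℕ.* k ℕ.^ j ℕ.≤ p × fromℕ p ≤ (V + ε) * fromℕ (suc (k ℕ.+ a) ℕ.^ j))) →
  V ≡ fromℕ N
asymptotically-equal {V} N j a upper lower = ℚ.≤-antisym (≤-+-ε V≤N+ε) (≤-+-ε N≤V+ε)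
  where
  N≤V+ε : ∀ ε → 0ℚ < ε → fromℕ N ≤ V + ε
  N≤V+ε ε 0<ε = leading-≤ {fromℕ N} {V + ε} (suc a) j (proj₁ (lower ε 0<ε)) (0≤fromℕ N) λ k K≤k →
    let p , N≤p , p≤V+ε = proj₂ (lower ε 0<ε) k K≤k
    in ℚ.≤-trans (subst (_≤ fromℕ p) (fromℕ-homo-* N (k ℕ.^ j)) (fromℕ-mono-≤ N≤p))
         (subst (λ m → fromℕ p ≤ (V + ε) * fromℕ (m ℕ.^ j)) (sym (ℕ.+-suc k a)) p≤V+ε)
  V-ε≤N : ∀ ε → 0ℚ < ε → V - ε ≤ fromℕ N
  -- `leading-≤` requires a nonnegative left coefficient; if V - ε ≤ 0 the bound is immediate.
  V-ε≤N ε 0<ε with ℚ.≤-total 0ℚ (V - ε)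
  ... | inj₂ V-ε≤0 = ℚ.≤-trans V-ε≤0 (0≤fromℕ N)
  ... | inj₁ 0≤V-ε = leading-≤ {V - ε} {fromℕ N} j j (proj₁ (upper ε 0<ε)) 0≤V-ε λ k K≤k →
    let p , V-ε≤p , p≤N = proj₂ (upper ε 0<ε) k K≤k
    in ℚ.≤-trans V-ε≤p (subst (fromℕ p ≤_) (fromℕ-homo-* N ((k ℕ.+ j) ℕ.^ j)) (fromℕ-mono-≤ p≤N))
  V≤N+ε : ∀ ε → 0ℚ < ε → V ≤ fromℕ N + ε
  V≤N+ε ε 0<ε = subst (_≤ fromℕ N + ε) (ℚRing.//-rightDividesˡ ε V) (ℚ.+-monoˡ-≤ ε (V-ε≤N ε 0<ε))

module _ {n : ℕ} (P : LatticeSimplex n) where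

  private G₀ = Vec ℚ (suc n) × ℕ

  -- Adding k - h copies of the first vertex brings every box point to the common height k. There it
  -- lies in a tile of a finite covering of P, and by uniqueness of the decomposition the tile
  -- determines the box point.
  ¬¬-boxPoints : ∀ {V} → IsNormalizedVolume P ⊤ n V →
    DoubleNegation (∃[ gs ] Unique gs × All (BoxPoint P) gs × (∀ {g} → BoxPoint P g → g ∈ gs))
  ¬¬-boxPoints {V} (L , content) = ¬¬-enumeration (BoxPoint P) R zs total inj
    where
    -- Any positive ε would do: what matters is that the covering is finite.
    eventually = content 1ℚ (fromℕ-mono-< {0} {1} ℕ.z<s)
    K = proj₁ eventually
    -- At least n + 1, which bounds the heights of box points, and at least K, so that the covering
    -- exists.
    k = suc (n ℕ.+ K)
    covering = proj₂ (proj₂ eventually k (ℕ.≤-trans (ℕ.m≤n+m K n) (ℕ.n≤1+n _)))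
    zs = proj₁ covering
    R : G₀ → Vec ℤ n → Set
    R g z = ∃[ xs ] proj₂ g ℕ.≤ k × xs ∈ compositions ⊤ (k ∸ proj₂ g) × Represents P L k (translate P (g , xs)) z
    concentrated : ∀ {m} → ℕ → Vec ℕ (suc m)
    concentrated l = l ∷ Vec.replicate _ 0
    sum-concentrated : ∀ m l → Vec.sum (concentrated {m} l) ≡ l
    sum-concentrated m l = trans (cong (l ℕ.+_) (sum-zeros m)) (ℕ.+-identityʳ l)
      where
      sum-zeros : ∀ m → Vec.sum (Vec.replicate m 0) ≡ 0
      sum-zeros zero    = refl
      sum-zeros (suc m) = sum-zeros m
    total : ∀ {g} → BoxPoint P g → ∃[ z ] z ∈ zs × R g z
    total {g} box =
      let h≤k = ℕ.≤-trans (height≤ P box) (ℕ.s≤s (ℕ.m≤m+n n K))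
          xs∈ = compositions-complete ⊤ (k ∸ proj₂ g) (concentrated _) (sum-concentrated n _) (λ i i∉⊤ → contradiction ∈⊤ i∉⊤)
          cone , off = translate-cone P box (λ _ → ∈⊤) h≤k xs∈
          z , meets , rep = conePoint⇒tile P L (n ℕ.+ K) cone off
      in z , proj₁ (proj₂ covering) z meets , _ , h≤k , xs∈ , rep
    inj : ∀ {g g′ z} → BoxPoint P g → BoxPoint P g′ → R g z → R g′ z → g ≡ g′
    inj {g} {g′} {z} box box′ (xs , h≤k , xs∈ , r) (xs′ , h′≤k , xs∈′ , r′) =
      let conePoint _ sum≡ _ , _ = translate-cone P {xs = xs} box (λ _ → ∈⊤) h≤k xs∈
          conePoint _ sum≡′ _ , _ = translate-cone P {xs = xs′} box′ (λ _ → ∈⊤) h′≤k xs∈′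
      in cong proj₁ (translate-injective P {xs = xs} {xs′} box box′
           (represents-injectiveˡ P L {z = z} (trans sum≡ (sym sum≡′)) r r′))

  module _ {gs : List G₀} (gs-unique : Unique gs) (gs-box : All (BoxPoint P) gs)
           (gs-complete : ∀ {g} → BoxPoint P g → g ∈ gs)
           {F : Subset (suc n)} {j : ℕ} (∣F∣≡ : ∣ F ∣ ≡ suc j) (L : LatticeFrame P F j) where

    open LatticeFrame L

    private
      inF? = λ (g : G₀) → support P g ⊆? F
      G = filter inF? gs
      N = countBelow (support P) gs F

      -- For k ≥ n + 1 these pairs encode each lattice point of the k-th dilate of the face exactly
      -- once.
      W : ℕ → List (G₀ × Vec ℕ (suc n))
      W k = translates proj₂ F k G

      W-unique : ∀ k → Unique (W k)
      W-unique k = translates-unique proj₂ F k (Unique.filter⁺ inF? gs-unique)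

      R : ℕ → G₀ × Vec ℕ (suc n) → Vec ℤ j → Set
      R k w z = Represents P L k (translate P w) z

      W-box : ∀ {k g xs} → (g , xs) ∈ W k → BoxPoint P g × support P g ⊆ F × xs ∈ compositions F (k ∸ proj₂ g)
      W-box {k} {g} w∈ =
        let g∈ , xs∈ = ∈-translates⁻ proj₂ F k w∈
            g∈gs , S⊆F = ∈-filter⁻ inF? g∈
        in All.lookup gs-box g∈gs , S⊆F , xs∈

    -- Every lattice point of the dilated face is the scaled corner of a tile that meets the face,
    -- and distinct points give distinct tiles.
    count-≤-covering : ∀ k′ {zs} → suc n ℕ.≤ suc k′ → (∀ z → TileMeets (suc k′) z → z ∈ zs) →
      length (W (suc k′)) ℕ.≤ length zs
    count-≤-covering k′ {zs} n<k cover = length-≤-by-injection (R k) (W-unique k) total inj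
      where
      k = suc k′
      cone : ∀ {g xs} → (g , xs) ∈ W k → ConePoint P k (translate P (g , xs)) × VanishesOffℚ F (translate P (g , xs))
      cone {g} {xs} w∈ = let box , S⊆F , xs∈ = W-box w∈ in
        translate-cone P {xs = xs} box S⊆F (ℕ.≤-trans (height≤ P box) n<k) xs∈
      total : ∀ {w} → w ∈ W k → ∃[ z ] z ∈ zs × R k w z
      total {g , xs} w∈ =
        let μ-cone , off = cone w∈
            z , meets , rep = conePoint⇒tile P L k′ μ-cone off
        in z , cover z meets , rep
      inj : ∀ {w w′ z} → w ∈ W k → w′ ∈ W k → R k w z → R k w′ z → w ≡ w′
      inj {g , xs} {g′ , xs′} {z} w∈ w′∈ r r′ = translate-injective P {xs = xs} {xs′} (proj₁ (W-box w∈)) (proj₁ (W-box w′∈))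
        (represents-injectiveˡ P L {z = z} (trans (ConePoint.sum≡ (proj₁ (cone w∈))) (sym (ConePoint.sum≡ (proj₁ (cone w′∈))))) r r′)

    -- The scaled corner of a tile inside the face is a lattice point of the dilated face, so it
    -- decomposes into a box point and a composition.
    packing-≤-count : ∀ k′ {zs} → Unique zs → All (TileInside (suc k′)) zs → length zs ℕ.≤ length (W (suc k′))
    packing-≤-count k′ {zs} zs-unique tiles = length-≤-by-injection (λ z w → R k w z) zs-unique total (λ {_} {_} {w} → inj {w = w})
      where
      k = suc k′
      total : ∀ {z} → z ∈ zs → ∃[ w ] w ∈ W k × R k w z
      total {z} z∈ =
        let μ , μ-cone , off , represents r = tile⇒conePoint P L k′ z (All.lookup tiles z∈)
            g , xs , box , S⊆F , xs∈ , translate≡ = decompose P μ-cone off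
        in (g , xs) , ∈-translates⁺ proj₂ F k (∈-filter⁺ inF? (gs-complete box) S⊆F) xs∈
           , represents (λ a → trans (combination-cong (vertex P) a translate≡) (r a))
      inj : ∀ {z z′ w} → z ∈ zs → z′ ∈ zs → R k w z → R k w z′ → z ≡ z′
      inj {w = w} _ _ r r′ = represents-injectiveʳ P L {k = k} {μ = translate P w} r r′

    content≡count : ∀ {V} → HasContent V → V ≡ fromℕ N
    content≡count {V} content = asymptotically-equal N j n upper lower
      where
      upper : ∀ ε → 0ℚ < ε → ∃[ K ] (∀ k → K ℕ.≤ k → ∃[ p ] (V - ε) * fromℕ (k ℕ.^ j) ≤ fromℕ p × p ℕ.≤ N ℕ.* (k ℕ.+ j) ℕ.^ j)
      -- The successor forces k ≥ 1, since tiles are compared with lattice points only at positive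
      -- scales.
      upper ε 0<ε = suc K , bound
        where
        K = proj₁ (content ε 0<ε)
        bound : ∀ k → suc K ℕ.≤ k → ∃[ p ] (V - ε) * fromℕ (k ℕ.^ j) ≤ fromℕ p × p ℕ.≤ N ℕ.* (k ℕ.+ j) ℕ.^ j
        bound k@(suc k′) K<k =
          let zs , zs-unique , tiles , V-ε≤ = proj₁ (proj₂ (content ε 0<ε) k (ℕ.<⇒≤ K<k))
          in j ! ℕ.* length zs , V-ε≤ , ℕ.≤-trans
               (ℕ.*-monoʳ-≤ (j !) (packing-≤-count k′ zs-unique tiles))
               (length-translates-≤ proj₂ F k ∣F∣≡ G)
      lower : ∀ ε → 0ℚ < ε → ∃[ K ] (∀ l → K ℕ.≤ l → ∃[ p ] N ℕ.* l ℕ.^ j ℕ.≤ p × fromℕ p ≤ (V + ε) * fromℕ (suc (l ℕ.+ n) ℕ.^ j))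
      lower ε 0<ε = K , bound
        where
        K = proj₁ (content ε 0<ε)
        bound : ∀ l → K ℕ.≤ l → ∃[ p ] N ℕ.* l ℕ.^ j ℕ.≤ p × fromℕ p ≤ (V + ε) * fromℕ (suc (l ℕ.+ n) ℕ.^ j)
        -- The scale is l + n + 1: box points have height at most n + 1, so each leaves at least l
        -- for its compositions.
        bound l K≤l =
          let zs , cover , ≤V+ε = proj₂ (proj₂ (content ε 0<ε) (suc (l ℕ.+ n)) (ℕ.m≤n⇒m≤1+n (ℕ.m≤n⇒m≤n+o n K≤l)))
          in j ! ℕ.* length zs
             , ℕ.≤-trans
                 (length-translates-≥ proj₂ F (suc (l ℕ.+ n)) l ∣F∣≡ (All.tabulate heights))
                 (ℕ.*-monoʳ-≤ (j !) (count-≤-covering (l ℕ.+ n) (ℕ.s≤s (ℕ.m≤n+m n l)) cover))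
             , ≤V+ε
          where
          heights : ∀ {g} → g ∈ G → l ℕ.+ proj₂ g ℕ.≤ suc (l ℕ.+ n)
          heights {g} g∈ = subst (l ℕ.+ proj₂ g ℕ.≤_) (ℕ.+-suc l n)
            (ℕ.+-monoʳ-≤ l (height≤ P (All.lookup gs-box (proj₁ (∈-filter⁻ inF? g∈)))))

c-nonNegative : (n : ℕ) (P : LatticeSimplex n) (vol : Subset (suc n) → ℚ) → IsVolumeFunction P vol → 0ℚ ≤ c n vol
c-nonNegative n P vol isVol = decidable-stable (0ℚ ℚ.≤? c n vol)
  (¬¬-map fromBox (¬¬-boxPoints P {vol ⊤} (isVol n ⊤ (∣⊤∣≡n (suc n)))))
  where
  fromBox : ∃[ gs ] Unique gs × All (BoxPoint P) gs × (∀ {g} → BoxPoint P g → g ∈ gs) → 0ℚ ≤ c n vol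
  fromBox (gs , unique , box , complete) = subst (0ℚ ≤_)
    (sym (trans (c-as-alternatingSum n vol) (alternatingSum-cong term)))
    (alternatingSum-countBelow (support P) gs)
    where
    -- The cardinality is generalized to t so that it can be split: at 0 the weight removes the
    -- unconstrained volume of the empty set, and at j + 1 the content of a j-dimensional face is
    -- available.
    term-at : ∀ F t → ∣ F ∣ ≡ t → fromℕ t * vol F ≡ fromℕ t * fromℕ (countBelow (support P) gs F)
    term-at F zero    _    = trans (ℚ.*-zeroˡ (vol F)) (sym (ℚ.*-zeroˡ (fromℕ (countBelow (support P) gs F))))
    term-at F (suc j) ∣F∣≡ = let L , content = isVol j F ∣F∣≡ in
      cong (_*_ (fromℕ (suc j))) (content≡count P unique box complete ∣F∣≡ L content)
    term : ∀ F → fromℕ ∣ F ∣ * vol F ≡ fromℕ ∣ F ∣ * fromℕ (countBelow (support P) gs F)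
    term F = term-at F ∣ F ∣ refl

proposition3p2 : (n : ℕ) → 2 ℕ.≤ n → (P : LatticeSimplex n) →
    (vol : Subset (suc n) → ℚ) → IsVolumeFunction P vol → 0ℚ ≤ c n vol
proposition3p2 n _ = c-nonNegative n
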